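{- Let $\mathfrak R$ be a total Quantum Term Rewrite System (QTRS). Then $\mathrm{NF}_{\mathfrak R}$ is exactly the set of well-typed ground terms equivalent (for $\equiv$) to values.
   Context: **Syntax.** $\mathcal X$ is a countable set of variables; $\mathcal A,\mathcal C,\mathcal F$ are pairwise disjoint signatures (symbols $b$ with arity $\mathrm{ar}(b)\in\mathbb N$) of amplitude, constructor and function symbols. Constructors include a unit $()$, $|0\rangle$, $|1\rangle$, $\mathtt 0$ (arity 0), $\mathtt S$ (arity 1), pairing $(\cdot,\cdot)$ (arity 2), $[\,]$ (arity 0) and list-cons $h::t$ (arity 2). Grammar: naturals $\iota::=x\mid\mathtt 0\mid\mathtt S(\iota)$; amplitudes $\alpha::=\mathtt a(\iota,\dots,\iota)\mid\alpha\cdot\alpha\mid\alpha+\alpha$; terms $t::=x\mid c(t,\dots,t)\mid f(t,\dots,t)\mid\alpha\cdot t\mid t+t$; values $v::=c(v,\dots,v)\mid\alpha\cdot v\ (\alpha\text{ ground})\mid v+v$. A term or amplitude is ground if it has no variable; $\mathscr T_0$ is the set of ground terms. A term is classical if it contains neither $+$ nor $\alpha\cdot$. A substitution $\sigma$ maps variables to values. **Amplitudes.** Each $\mathtt a\in\mathcal A$ has a total interpretation $[\![\mathtt a]\!]:\mathbb N^{\mathrm{ar}(\mathtt a)}\to\mathbb C$, extended to ground amplitudes in the obvious way (sums to sums, products to products, $\mathtt S^n(\mathtt 0)$ to $n$). For a non-ground $\alpha$, $[\![\alpha]\!]=\lambda$ means $[\![\alpha\sigma]\!]=\lambda$ for every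 $\sigma$ such that $\alpha\sigma$ is a ground amplitude. **Equivalence.** $\equiv$ is the smallest equivalence relation on terms, closed under all term contexts ($s\equiv t\Rightarrow C[s]\equiv C[t]$), with: $t_1+t_2\equiv t_2+t_1$; $t_1+(t_2+t_3)\equiv(t_1+t_2)+t_3$; $s+\alpha\cdot t\equiv s$ if $[\![\alpha]\!]=0$; $\alpha\cdot t\equiv t$ if $[\![\alpha]\!]=1$; $\alpha\cdot(\beta\cdot t)\equiv(\alpha\cdot\beta)\cdot t$; $\alpha\cdot(t_1+t_2)\equiv\alpha\cdot t_1+\alpha\cdot t_2$; $\alpha\cdot t+\beta\cdot t\equiv(\alpha+\beta)\cdot t$; and, for $b\in\mathcal C\uplus\mathcal F$, $b(\dots,\alpha\cdot t,\dots)\equiv\alpha\cdot b(\dots,t,\dots)$ and $b(\dots,t_1+t_2,\dots)\equiv b(\dots,t_1,\dots)+b(\dots,t_2,\dots)$. A canonical form of $t$ is a term $\sum_{i=1}^n\alpha_i\cdot t_i\equiv t$ with the $t_i$ pairwise distinct classical terms and $[\![\alpha_i]\!]\neq0$; $\mathrm{CAN}$ is the set of canonical forms. **STRS.** A rewrite rule is $l\to r$ with $l=f(p_1,\dots,p_n)$, $f\in\mathcal F$, each $p_i$ a classical term without function symbols, and $\mathrm{Var}(r)\subseteq\mathrm{Var}(l)$. An STRS $\mathfrak R$ consists of $\mathcal A,\mathcal C,\mathcal F,\mathcal X$, a set $\mathcal R$ of orthogonal rules (left-linear and with pairwise non-overlapping left-hand sides), and a main symbol $f\in\mathcal F$. **Reduction.**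 Evaluation contexts: $E::=\diamond\mid b(v_1,\dots,v_{i-1},E,t_{i+1},\dots,t_n)$ with $b\in\mathcal C\uplus\mathcal F$ and $v_j$ values. $\to_{\mathfrak R}\subseteq\mathscr T_0\times\mathscr T_0$ is defined inductively by: (C) if $l\to r\in\mathcal R$ and $E[l\sigma]$ is classical then $E[l\sigma]\to_{\mathfrak R}E[r\sigma]$; (E) if $s\equiv s'\to_{\mathfrak R}t'\equiv t$ then $s\to_{\mathfrak R}t$; (Q) if $\sum_i\alpha_i\cdot s_i\in\mathrm{CAN}$, $s_i\to^?_{\mathfrak R}t_i$ for all $i$, and $s_i\to_{\mathfrak R}t_i$ for some $i$, then $\sum_i\alpha_i\cdot s_i\to_{\mathfrak R}\sum_i\alpha_i\cdot t_i$. Here $s\to^?_{\mathfrak R}t$ iff ($s\in\mathrm{NF}_{\mathfrak R}$ and $t=s$) or $s\to_{\mathfrak R}t$, and $\mathrm{NF}_{\mathfrak R}=\{s\in\mathscr T_0\mid\nexists t,\ s\to_{\mathfrak R}t\}$ is the set of normal forms. $\to^*_{\mathfrak R}$ is the reflexive transitive closure. **Types.** There is a countable set of basic types (containing $\mathbb 1$, $\mathtt{Qbit}$, $\mathtt{nat}$, lists, pairs). Each $b\in\mathcal C\uplus\mathcal F$ has a unique signature $T_1\times\dots\times T_n\to T$ ($n=\mathrm{ar}(b)$), with the expected ones for the constructors above (polymorphic constructors have one copy per type). Quantum types form the least set containing $\mathtt{Qbit}$ and every $T$ such that some $c\in\mathcal C$ has signature $T_1\times\dots\times T_n\to T$ with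 some $T_i$ quantum; other types are classical. Contexts $\Gamma$ (non-linear), $\Delta$ (linear) are sets of typed distinct variables; contexts written together ($\Gamma,\Delta$ or $\Gamma;\Delta$) have disjoint domains. $\mathrm{Sub}_0(\Theta)$ is the set of substitutions $\sigma$ with $x\sigma$ a well-typed value of type $T$ for each $x:T\in\Theta$. Amplitude judgments $\Gamma\Vdash\alpha$: $\Gamma\Vdash\mathtt a(\iota_1,\dots,\iota_n)$ if $\Gamma;\varnothing\vdash\iota_i:\mathtt{nat}$ for all $i$; closed under $+$ and $\cdot$. Term judgments $\Gamma;\Delta\vdash_{\mathfrak R}t:T$: (var) $\Gamma,x:C;\varnothing\vdash x:C$ for $C$ classical and $\Gamma;x:Q\vdash x:Q$ for $Q$ quantum; (equiv) from $\Gamma;\Delta\vdash s:T$, $s\equiv t$, and the variables of $t$ in $\mathrm{Dom}(\Gamma\cup\Delta)$, infer $\Gamma;\Delta\vdash t:T$; (symb) if $b$ has signature $T_1\times\dots\times T_n\to T$ and $\Gamma;\Delta_i\vdash t_i:T_i$ for all $i$, then $\Gamma;\Delta_1,\dots,\Delta_n\vdash b(t_1,\dots,t_n):T$; (sup) if $Q$ is quantum, $\Gamma;\Delta\vdash t_i:Q$ and $\Gamma\Vdash\alpha_i$ for all $i$, $\sum_i|[\![\alpha_i\sigma]\!]|^2=1$ for all $\sigma\in\mathrm{Sub}_0(\Gamma)$, and $t_i\perp_{\mathfrak R}t_j$ for $i\ne j$, then $\Gamma;\Delta\vdash\sum_i\alpha_i\cdot t_i:Q$. $\vdash_{\mathfrak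 R}t:T$ abbreviates $\varnothing;\varnothing\vdash_{\mathfrak R}t:T$. Orthogonality: $\delta_\perp$ is the partial map on pairs of classical terms with $\delta_\perp(t,t)=1$ and $\delta_\perp(s,t)=0$ if $s=C[|q\rangle,s_1,\dots,s_n]$, $t=C[|1-q\rangle,t_1,\dots,t_n]$ for some $(n+1)$-hole context $C$, $q\in\{0,1\}$ and terms $s_i,t_i$. For $s,t$ with $\Gamma;\Delta\vdash s:T$, $\Gamma;\Delta\vdash t:T$: $s\perp_{\mathfrak R}t$ iff for all $\sigma\in\mathrm{Sub}_0(\Gamma\cup\Delta)$, $s\sigma\to^*_{\mathfrak R}\sum_{i=1}^n\alpha_i\cdot v_i\in\mathrm{CAN}$ and $t\sigma\to^*_{\mathfrak R}\sum_{j=1}^m\beta_j\cdot w_j\in\mathrm{CAN}$ with $v_i,w_j$ classical values, every $\delta_\perp(v_i,w_j)$ is defined, and $\sum_{i,j}[\![\alpha_i]\!][\![\beta_j]\!]^*\delta_\perp(v_i,w_j)=0$. **QTRS.** For $b$ with signature $T_1\times\dots\times T_n\to T$, $\mathrm{In}(b)$ is the set of tuples $\overline v=(v_1,\dots,v_n)$ of values with $\vdash_{\mathfrak R}v_i:T_i$; $\overline v\perp_{\mathfrak R}\overline w$ iff $v_i\perp_{\mathfrak R}w_i$ for some $i$. $f\in\mathcal F$ is an isometry if $\overline v\perp_{\mathfrak R}\overline w$ implies $f(\overline v)\perp_{\mathfrak R}f(\overline w)$ for all $\overline v,\overline w\in\mathrm{In}(f)$. A QTRS is an STRS whose function symbols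 are all isometries and such that for each rule $l\to r$ and all $\Gamma,\Delta,T$, $\Gamma;\Delta\vdash_{\mathfrak R}l:T$ implies $\Gamma;\Delta\vdash_{\mathfrak R}r:T$. **Total.** A QTRS is total if for any $f\in\mathcal F$ and any $\overline v\in\mathrm{In}(f)$ there exist a substitution $\sigma$ and a rule $l\to r\in\mathcal R$ with $l\sigma=f(\overline v)$.
   Formalization: The equality is stated within the well-typed ground terms: such a term is in NF iff it is equivalent to a value; without this, S(|0⟩) is an ill-typed normal form and the claim fails. Equality of symbols is taken to be decidable, as it is classically. -}

module Defs where

open import Data.Bool.Base using (Bool; true; false; not)
open import Data.Empty using (⊥)
open import Data.Fin.Base using (Fin; zero; suc; _<_)
open import Data.Fin.Properties using () renaming (_≟_ to _≟ᶠ_)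
open import Data.List.Base using (List; []; _∷_; _++_; map)
import Data.List.Base as List
open import Data.List.Membership.Propositional using (_∈_)
open import Data.List.Relation.Binary.Permutation.Propositional using (_↭_)
open import Data.List.Relation.Binary.Subset.Propositional using (_⊆_)
open import Data.List.Relation.Unary.Unique.Propositional using (Unique)
open import Data.Nat.Base as ℕ using (ℕ; zero; suc)
import Data.Nat.Properties as ℕ
open import Data.Product.Base using (∃; _×_; _,_; proj₁; proj₂)
open import Data.Rational.Base as ℚ using (ℚ; 0ℚ; 1ℚ; ½; Positive; NonNegative; NonZero)
import Data.Rational.Properties as ℚ
open import Data.Rational.Solver using (module +-*-Solver)
open import Data.Sum.Base using (_⊎_; inj₁; inj₂)
open import Data.Vec.Base as Vec using (Vec; []; _∷_; lookup; _[_]≔_)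
open import Data.Vec.Relation.Unary.All using (All)
open import Function.Base using (_∘_)
open import Function.Bundles using (_↣_)
open import Relation.Binary.Construct.Closure.ReflexiveTransitive using (Star)
open import Relation.Binary.Definitions using (DecidableEquality)
open import Relation.Binary.PropositionalEquality using (_≡_; _≢_; refl; sym; trans; cong; cong₂; subst)
open import Relation.Nullary using (¬_; yes; no)

-- Cauchy sequences of rationals with a modulus of convergence; equality is
-- the setoid relation _≈ℝ_, and the operations are pointwise.

record ℝ : Set where
  constructor mkℝ
  field
    seq    : ℕ → ℚ
    cauchy : (ε : ℚ) .{{_ : Positive ε}} →
             ∃ λ N → ∀ m n → N ℕ.≤ m → N ℕ.≤ n → ℚ.∣ seq m ℚ.- seq n ∣ ℚ.< ε

open ℝ public

infix 4 _≈ℝ_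

record _≈ℝ_ (x y : ℝ) : Set where
  constructor mk≈ℝ
  field
    close : (ε : ℚ) .{{_ : Positive ε}} →
            ∃ λ N → ∀ n → N ℕ.≤ n → ℚ.∣ seq x n ℚ.- seq y n ∣ ℚ.< ε

half : ℚ → ℚ
half ε = ½ ℚ.* ε

half-pos : ∀ ε .{{_ : Positive ε}} → Positive (half ε)
half-pos ε = ℚ.pos*pos⇒pos ½ ε

half+half : ∀ ε → half ε ℚ.+ half ε ≡ ε
half+half ε = trans (sym (ℚ.*-distribʳ-+ ε ½ ½)) (ℚ.*-identityˡ ε)

abs-nonNeg : ∀ p → NonNegative ℚ.∣ p ∣
abs-nonNeg p = ℚ.nonNegative (ℚ.0≤∣p∣ p)

ratℝ : ℚ → ℝ
seq    (ratℝ q) _ = q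
cauchy (ratℝ q) ε = 0 , λ _ _ _ _ →
  subst (ℚ._< ε) (sym (cong ℚ.∣_∣ (ℚ.+-inverseʳ q))) (ℚ.positive⁻¹ ε)

infixl 6 _+ℝ_
infixl 7 _*ℝ_
infix  8 -ℝ_

_+ℝ_ : ℝ → ℝ → ℝ
seq    (x +ℝ y) n = seq x n ℚ.+ seq y n
cauchy (x +ℝ y) ε = close ε {{half-pos ε}}
  where
  open ℚ.≤-Reasoning
  regroup : ∀ a b c d → (a ℚ.+ b) ℚ.- (c ℚ.+ d) ≡ (a ℚ.- c) ℚ.+ (b ℚ.- d)
  regroup = solve 4 (λ a b c d → (a :+ b) :- (c :+ d) := (a :- c) :+ (b :- d)) refl
    where open +-*-Solver
  close : (ε : ℚ) .{{_ : Positive (half ε)}} → ∃ λ N → ∀ m n → N ℕ.≤ m → N ℕ.≤ n →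
          ℚ.∣ (seq x m ℚ.+ seq y m) ℚ.- (seq x n ℚ.+ seq y n) ∣ ℚ.< ε
  close ε with cauchy x (half ε) | cauchy y (half ε)
  ... | M , x-close | N , y-close = M ℕ.+ N , λ m n m≥ n≥ → begin-strict
    ℚ.∣ (seq x m ℚ.+ seq y m) ℚ.- (seq x n ℚ.+ seq y n) ∣
      ≡⟨ cong ℚ.∣_∣ (regroup (seq x m) (seq y m) (seq x n) (seq y n)) ⟩
    ℚ.∣ (seq x m ℚ.- seq x n) ℚ.+ (seq y m ℚ.- seq y n) ∣
      ≤⟨ ℚ.∣p+q∣≤∣p∣+∣q∣ (seq x m ℚ.- seq x n) (seq y m ℚ.- seq y n) ⟩
    ℚ.∣ seq x m ℚ.- seq x n ∣ ℚ.+ ℚ.∣ seq y m ℚ.- seq y n ∣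
      <⟨ ℚ.+-mono-< (x-close m n (ℕ.m+n≤o⇒m≤o M m≥) (ℕ.m+n≤o⇒m≤o M n≥))
                    (y-close m n (ℕ.m+n≤o⇒n≤o M m≥) (ℕ.m+n≤o⇒n≤o M n≥)) ⟩
    half ε ℚ.+ half ε
      ≡⟨ half+half ε ⟩
    ε ∎

-ℝ_ : ℝ → ℝ
seq    (-ℝ x) n = ℚ.- seq x n
cauchy (-ℝ x) ε = let N , close = cauchy x ε in
  N , λ m n m≥ n≥ → subst (ℚ._< ε) (flip-sign (seq x m) (seq x n)) (close m n m≥ n≥)
  where
  flip-sign : ∀ a b → ℚ.∣ a ℚ.- b ∣ ≡ ℚ.∣ (ℚ.- a) ℚ.- (ℚ.- b) ∣
  flip-sign a b = trans (sym (ℚ.∣-p∣≡∣p∣ (a ℚ.- b))) (cong ℚ.∣_∣ (ℚ.neg-distrib-+ a (ℚ.- b)))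

eventually-bounded : (x : ℝ) →
  ∃ λ N → ∀ n → N ℕ.≤ n → ℚ.∣ seq x n ∣ ℚ.≤ ℚ.∣ seq x N ∣ ℚ.+ 1ℚ
eventually-bounded x with cauchy x 1ℚ
... | N , close = N , λ n n≥ → begin
  ℚ.∣ seq x n ∣
    ≡⟨ cong ℚ.∣_∣ (split (seq x n) (seq x N)) ⟩
  ℚ.∣ seq x N ℚ.+ (seq x n ℚ.- seq x N) ∣
    ≤⟨ ℚ.∣p+q∣≤∣p∣+∣q∣ (seq x N) (seq x n ℚ.- seq x N) ⟩
  ℚ.∣ seq x N ∣ ℚ.+ ℚ.∣ seq x n ℚ.- seq x N ∣
    ≤⟨ ℚ.+-monoʳ-≤ ℚ.∣ seq x N ∣ (ℚ.<⇒≤ (close n N n≥ ℕ.≤-refl)) ⟩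
  ℚ.∣ seq x N ∣ ℚ.+ 1ℚ ∎
  where
  open ℚ.≤-Reasoning
  split : ∀ a b → a ≡ b ℚ.+ (a ℚ.- b)
  split = solve 2 (λ a b → a := b :+ (a :- b)) refl
    where open +-*-Solver

_*ℝ_ : ℝ → ℝ → ℝ
seq    (x *ℝ y) n = seq x n ℚ.* seq y n
cauchy (x *ℝ y)   = close
  where
  open ℚ.≤-Reasoning

  regroup : ∀ a b c d → a ℚ.* b ℚ.- c ℚ.* d ≡ a ℚ.* (b ℚ.- d) ℚ.+ d ℚ.* (a ℚ.- c)
  regroup = solve 4 (λ a b c d → a :* b :- c :* d := a :* (b :- d) :+ d :* (a :- c)) refl
    where open +-*-Solver

  mul-mono : ∀ a b K δ .{{_ : Positive K}} →
             ℚ.∣ a ∣ ℚ.≤ K → ℚ.∣ b ∣ ℚ.< δ → ℚ.∣ a ℚ.* b ∣ ℚ.< K ℚ.* δ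
  mul-mono a b K δ a≤ b< = begin-strict
    ℚ.∣ a ℚ.* b ∣          ≡⟨ ℚ.∣p*q∣≡∣p∣*∣q∣ a b ⟩
    ℚ.∣ a ∣ ℚ.* ℚ.∣ b ∣    ≤⟨ ℚ.*-monoʳ-≤-nonNeg ℚ.∣ b ∣ {{abs-nonNeg b}} a≤ ⟩
    K ℚ.* ℚ.∣ b ∣          <⟨ ℚ.*-monoʳ-<-pos K b< ⟩
    K ℚ.* δ                ∎

  M₀ = eventually-bounded x .proj₁
  N₀ = eventually-bounded y .proj₁
  Bx By K : ℚ
  Bx = ℚ.∣ seq x M₀ ∣ ℚ.+ 1ℚ
  By = ℚ.∣ seq y N₀ ∣ ℚ.+ 1ℚ
  K  = Bx ℚ.+ By

  instance
    Bx-pos : Positive Bx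
    Bx-pos = ℚ.nonNeg+pos⇒pos ℚ.∣ seq x M₀ ∣ {{abs-nonNeg (seq x M₀)}} 1ℚ
    By-pos : Positive By
    By-pos = ℚ.nonNeg+pos⇒pos ℚ.∣ seq y N₀ ∣ {{abs-nonNeg (seq y N₀)}} 1ℚ
    K-pos : Positive K
    K-pos = ℚ.pos+nonNeg⇒pos Bx By {{ℚ.pos⇒nonNeg By}}
    K-nonZero : NonZero K
    K-nonZero = ℚ.pos⇒nonZero K

  Bx≤K : Bx ℚ.≤ K
  Bx≤K = subst (ℚ._≤ K) (ℚ.+-identityʳ Bx) (ℚ.+-monoʳ-≤ Bx (ℚ.<⇒≤ (ℚ.positive⁻¹ By)))
  By≤K : By ℚ.≤ K
  By≤K = subst (ℚ._≤ K) (ℚ.+-identityˡ By) (ℚ.+-monoˡ-≤ By (ℚ.<⇒≤ (ℚ.positive⁻¹ Bx)))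

  δ : ℚ → ℚ
  δ ε = ℚ.1/ K ℚ.* half ε

  K*δ : ∀ ε → K ℚ.* δ ε ≡ half ε
  K*δ ε = trans (sym (ℚ.*-assoc K (ℚ.1/ K) (half ε)))
         (trans (cong (ℚ._* half ε) (ℚ.*-inverseʳ K)) (ℚ.*-identityˡ (half ε)))

  close : (ε : ℚ) .{{_ : Positive ε}} → ∃ λ N → ∀ m n → N ℕ.≤ m → N ℕ.≤ n →
          ℚ.∣ seq x m ℚ.* seq y m ℚ.- seq x n ℚ.* seq y n ∣ ℚ.< ε
  close ε = (M₀ ℕ.+ N₀) ℕ.+ (M ℕ.+ N) , λ m n m≥ n≥ → begin-strict
    ℚ.∣ seq x m ℚ.* seq y m ℚ.- seq x n ℚ.* seq y n ∣
      ≡⟨ cong ℚ.∣_∣ (regroup (seq x m) (seq y m) (seq x n) (seq y n)) ⟩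
    ℚ.∣ seq x m ℚ.* (seq y m ℚ.- seq y n) ℚ.+ seq y n ℚ.* (seq x m ℚ.- seq x n) ∣
      ≤⟨ ℚ.∣p+q∣≤∣p∣+∣q∣ (seq x m ℚ.* (seq y m ℚ.- seq y n)) (seq y n ℚ.* (seq x m ℚ.- seq x n)) ⟩
    ℚ.∣ seq x m ℚ.* (seq y m ℚ.- seq y n) ∣ ℚ.+ ℚ.∣ seq y n ℚ.* (seq x m ℚ.- seq x n) ∣
      <⟨ ℚ.+-mono-<
           (mul-mono (seq x m) (seq y m ℚ.- seq y n) K (δ ε)
             (ℚ.≤-trans (x-bound m (ℕ.m+n≤o⇒m≤o M₀ (ℕ.m+n≤o⇒m≤o (M₀ ℕ.+ N₀) m≥))) Bx≤K)
             (y-close m n (late-N m≥) (late-N n≥)))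
           (mul-mono (seq y n) (seq x m ℚ.- seq x n) K (δ ε)
             (ℚ.≤-trans (y-bound n (ℕ.m+n≤o⇒n≤o M₀ (ℕ.m+n≤o⇒m≤o (M₀ ℕ.+ N₀) n≥))) By≤K)
             (x-close m n (late-M m≥) (late-M n≥))) ⟩
    K ℚ.* δ ε ℚ.+ K ℚ.* δ ε
      ≡⟨ cong₂ ℚ._+_ (K*δ ε) (K*δ ε) ⟩
    half ε ℚ.+ half ε
      ≡⟨ half+half ε ⟩
    ε ∎
    where
    instance
      δ-pos : Positive (δ ε)
      δ-pos = ℚ.pos*pos⇒pos (ℚ.1/ K) {{ℚ.1/pos⇒pos K}} (half ε) {{half-pos ε}}
    x-bound = proj₂ (eventually-bounded x)
    y-bound = proj₂ (eventually-bounded y)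
    M = proj₁ (cauchy x (δ ε))
    N = proj₁ (cauchy y (δ ε))
    x-close = proj₂ (cauchy x (δ ε))
    y-close = proj₂ (cauchy y (δ ε))
    late-M : ∀ {k} → (M₀ ℕ.+ N₀) ℕ.+ (M ℕ.+ N) ℕ.≤ k → M ℕ.≤ k
    late-M p = ℕ.m+n≤o⇒m≤o M (ℕ.m+n≤o⇒n≤o (M₀ ℕ.+ N₀) p)
    late-N : ∀ {k} → (M₀ ℕ.+ N₀) ℕ.+ (M ℕ.+ N) ℕ.≤ k → N ℕ.≤ k
    late-N p = ℕ.m+n≤o⇒n≤o M (ℕ.m+n≤o⇒n≤o (M₀ ℕ.+ N₀) p)

0ℝ 1ℝ : ℝ
0ℝ = ratℝ 0ℚ
1ℝ = ratℝ 1ℚ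

record ℂ : Set where
  constructor _+i_
  field
    re im : ℝ

open ℂ public

infix 4 _≈ℂ_

record _≈ℂ_ (z w : ℂ) : Set where
  constructor mk≈ℂ
  field
    re-≈ : re z ≈ℝ re w
    im-≈ : im z ≈ℝ im w

0ℂ 1ℂ : ℂ
re 0ℂ = 0ℝ
im 0ℂ = 0ℝ
re 1ℂ = 1ℝ
im 1ℂ = 0ℝ

infixl 6 _+ℂ_
infixl 7 _*ℂ_

_+ℂ_ _*ℂ_ : ℂ → ℂ → ℂ
re (z +ℂ w) = re z +ℝ re w
im (z +ℂ w) = im z +ℝ im w
re (z *ℂ w) = re z *ℝ re w +ℝ -ℝ (im z *ℝ im w)
im (z *ℂ w) = re z *ℝ im w +ℝ im z *ℝ re w

conj : ℂ → ℂ
re (conj z) = re z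
im (conj z) = -ℝ im z

∣_∣² : ℂ → ℝ
∣ z ∣² = re z *ℝ re z +ℝ im z *ℝ im z

∑ℝ : ∀ {n} → (Fin n → ℝ) → ℝ
∑ℝ {zero}  f = 0ℝ
∑ℝ {suc n} f = f zero +ℝ ∑ℝ (f ∘ suc)

∑ℂ : ∀ {n} → (Fin n → ℂ) → ℂ
∑ℂ {zero}  f = 0ℂ
∑ℂ {suc n} f = f zero +ℂ ∑ℂ (f ∘ suc)

Var : Set
Var = ℕ

data Type (BaseType : Set) : Set where
  𝟙 Qbit nat : Type BaseType
  list       : Type BaseType → Type BaseType
  _⊗_        : Type BaseType → Type BaseType → Type BaseType
  base       : BaseType → Type BaseType

-- The named constructors are built in, the polymorphic ones with one copy per
-- type; ConSym holds any further constructors. Decidability of equality of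
-- symbols is automatic in classical mathematics.
record Signature : Set₁ where
  field
    BaseType           : Set
    BaseType-countable : BaseType ↣ ℕ

    AmpSym  : Set
    _≟Amp_  : DecidableEquality AmpSym
    amp-ar  : AmpSym → ℕ
    amp-int : (a : AmpSym) → Vec ℕ (amp-ar a) → ℂ

    ConSym  : Set
    _≟Con_  : DecidableEquality ConSym
    con-ar  : ConSym → ℕ
    con-dom : (c : ConSym) → Vec (Type BaseType) (con-ar c)
    con-cod : ConSym → Type BaseType

    FunSym  : Set
    _≟Fun_  : DecidableEquality FunSym
    fun-ar  : FunSym → ℕ
    fun-dom : (f : FunSym) → Vec (Type BaseType) (fun-ar f)
    fun-cod : FunSym → Type BaseType

module _ (𝒮 : Signature) where
  open Signature 𝒮

  Ty : Set
  Ty = Type BaseType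

  data Con : Set where
    unit ket₀ ket₁ O S : Con
    pair               : Ty → Ty → Con
    nil cons           : Ty → Con
    con                : ConSym → Con

  Sym : Set
  Sym = Con ⊎ FunSym

  ar : Sym → ℕ
  ar (inj₁ unit)       = 0
  ar (inj₁ ket₀)       = 0
  ar (inj₁ ket₁)       = 0
  ar (inj₁ O)          = 0
  ar (inj₁ S)          = 1
  ar (inj₁ (pair _ _)) = 2
  ar (inj₁ (nil _))    = 0
  ar (inj₁ (cons _))   = 2
  ar (inj₁ (con c))    = con-ar c
  ar (inj₂ f)          = fun-ar f

  dom : (b : Sym) → Vec Ty (ar b)
  dom (inj₁ unit)       = []
  dom (inj₁ ket₀)       = []
  dom (inj₁ ket₁)       = []
  dom (inj₁ O)          = []
  dom (inj₁ S)          = nat ∷ []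
  dom (inj₁ (pair T U)) = T ∷ U ∷ []
  dom (inj₁ (nil _))    = []
  dom (inj₁ (cons T))   = T ∷ list T ∷ []
  dom (inj₁ (con c))    = con-dom c
  dom (inj₂ f)          = fun-dom f

  cod : Sym → Ty
  cod (inj₁ unit)       = 𝟙
  cod (inj₁ ket₀)       = Qbit
  cod (inj₁ ket₁)       = Qbit
  cod (inj₁ O)          = nat
  cod (inj₁ S)          = nat
  cod (inj₁ (pair T U)) = T ⊗ U
  cod (inj₁ (nil T))    = list T
  cod (inj₁ (cons T))   = list T
  cod (inj₁ (con c))    = con-cod c
  cod (inj₂ f)          = fun-cod f

  data Quantum : Ty → Set where
    qbit : Quantum Qbit
    con  : ∀ c i → Quantum (lookup (dom (inj₁ c)) i) → Quantum (cod (inj₁ c))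

  IsClassicalType : Ty → Set
  IsClassicalType T = ¬ Quantum T

  data NatExp : Set where
    nvar : Var → NatExp
    O    : NatExp
    S    : NatExp → NatExp

  infixr 7 _·ᵃ_
  infixr 6 _+ᵃ_

  data Amp : Set where
    amp       : (a : AmpSym) → Vec NatExp (amp-ar a) → Amp
    _·ᵃ_ _+ᵃ_ : Amp → Amp → Amp

  infixr 7 _•_
  infixr 6 _⊕_

  data Term : Set where
    var : Var → Term
    app : (b : Sym) → Vec Term (ar b) → Term
    _•_ : Amp → Term → Term
    _⊕_ : Term → Term → Term

module _ {𝒮 : Signature} where
  open Signature 𝒮

  fun : (f : FunSym) → Vec (Term 𝒮) (fun-ar f) → Term 𝒮
  fun f = app (inj₂ f)

  ket : Bool → Term 𝒮
  ket false = app (inj₁ ket₀) []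
  ket true  = app (inj₁ ket₁) []

  natTerm : NatExp 𝒮 → Term 𝒮
  natTerm (nvar x) = var x
  natTerm O        = app (inj₁ O) []
  natTerm (S ι)    = app (inj₁ S) (natTerm ι ∷ [])

  -- ∑ᵢ αᵢ · tᵢ over a nonempty index set, associated to the right.
  ⨁ : ∀ {n} → (Fin (suc n) → Amp 𝒮) → (Fin (suc n) → Term 𝒮) → Term 𝒮
  ⨁ {zero}  α t = α zero • t zero
  ⨁ {suc n} α t = (α zero • t zero) ⊕ ⨁ (α ∘ suc) (t ∘ suc)

  varsⁿ : NatExp 𝒮 → List Var
  varsⁿ (nvar x) = x ∷ []
  varsⁿ O        = []
  varsⁿ (S ι)    = varsⁿ ι

  varsᵃ : Amp 𝒮 → List Var
  varsᵃ (amp a ιs) = List.concatMap varsⁿ (Vec.toList ιs)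
  varsᵃ (α ·ᵃ β)   = varsᵃ α ++ varsᵃ β
  varsᵃ (α +ᵃ β)   = varsᵃ α ++ varsᵃ β

  vars  : Term 𝒮 → List Var
  vars* : ∀ {n} → Vec (Term 𝒮) n → List Var
  vars (var x)    = x ∷ []
  vars (app b ts) = vars* ts
  vars (α • t)    = varsᵃ α ++ vars t
  vars (s ⊕ t)    = vars s ++ vars t
  vars* []        = []
  vars* (t ∷ ts)  = vars t ++ vars* ts

  ampVars  : Term 𝒮 → List Var
  ampVars* : ∀ {n} → Vec (Term 𝒮) n → List Var
  ampVars (var x)    = []
  ampVars (app b ts) = ampVars* ts
  ampVars (α • t)    = varsᵃ α ++ ampVars t
  ampVars (s ⊕ t)    = ampVars s ++ ampVars t
  ampVars* []        = []
  ampVars* (t ∷ ts)  = ampVars t ++ ampVars* ts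

  GroundAmp : Amp 𝒮 → Set
  GroundAmp α = varsᵃ α ≡ []

  Ground : Term 𝒮 → Set
  Ground t = vars t ≡ []

  data Classical : Term 𝒮 → Set where
    var : ∀ x → Classical (var x)
    app : ∀ b {ts} → All Classical ts → Classical (app b ts)

  data Value : Term 𝒮 → Set where
    con   : ∀ c {vs} → All Value vs → Value (app (inj₁ c) vs)
    scale : ∀ {α v} → GroundAmp α → Value v → Value (α • v)
    plus  : ∀ {v w} → Value v → Value w → Value (v ⊕ w)

  data Pattern : Term 𝒮 → Set where
    var : ∀ x → Pattern (var x)
    con : ∀ c {ps} → All Pattern ps → Pattern (app (inj₁ c) ps)

  Subst : Set
  Subst = Var → Term 𝒮

  ValueSubst : Subst → Set
  ValueSubst σ = ∀ x → Value (σ x)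

  -- An amplitude argument must stay a natural, so a variable occurring there is
  -- replaced by the natural its instance denotes. To keep substitution total,
  -- any subterm which is not of the form x, 0 or S(…) is read as 0.
  toNatExp : Term 𝒮 → NatExp 𝒮
  toNatExp (var x)                 = nvar x
  toNatExp (app (inj₁ S) (t ∷ [])) = S (toNatExp t)
  toNatExp _                       = O

  substⁿ : Subst → NatExp 𝒮 → NatExp 𝒮
  substⁿ σ (nvar x) = toNatExp (σ x)
  substⁿ σ O        = O
  substⁿ σ (S ι)    = S (substⁿ σ ι)

  infixl 9 _[_]ᵃ _[_] _[_]*

  _[_]ᵃ : Amp 𝒮 → Subst → Amp 𝒮
  amp a ιs [ σ ]ᵃ = amp a (Vec.map (substⁿ σ) ιs)
  (α ·ᵃ β) [ σ ]ᵃ = (α [ σ ]ᵃ) ·ᵃ (β [ σ ]ᵃ)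
  (α +ᵃ β) [ σ ]ᵃ = (α [ σ ]ᵃ) +ᵃ (β [ σ ]ᵃ)

  _[_]  : Term 𝒮 → Subst → Term 𝒮
  _[_]* : ∀ {n} → Vec (Term 𝒮) n → Subst → Vec (Term 𝒮) n
  var x    [ σ ]  = σ x
  app b ts [ σ ]  = app b (ts [ σ ]*)
  (α • t)  [ σ ]  = (α [ σ ]ᵃ) • (t [ σ ])
  (s ⊕ t)  [ σ ]  = (s [ σ ]) ⊕ (t [ σ ])
  []       [ σ ]* = []
  (t ∷ ts) [ σ ]* = (t [ σ ]) ∷ (ts [ σ ]*)

  -- The clause for variables is never reached: ⟦_⟧ is applied to ground
  -- amplitudes only.
  ⟦_⟧ⁿ : NatExp 𝒮 → ℕ
  ⟦ nvar _ ⟧ⁿ = 0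
  ⟦ O ⟧ⁿ      = 0
  ⟦ S ι ⟧ⁿ    = suc ⟦ ι ⟧ⁿ

  ⟦_⟧ : Amp 𝒮 → ℂ
  ⟦ amp a ιs ⟧ = amp-int a (Vec.map ⟦_⟧ⁿ ιs)
  ⟦ α ·ᵃ β ⟧   = ⟦ α ⟧ *ℂ ⟦ β ⟧
  ⟦ α +ᵃ β ⟧   = ⟦ α ⟧ +ℂ ⟦ β ⟧

  infix 4 ⟦_⟧≐_ _≋_

  ⟦_⟧≐_ : Amp 𝒮 → ℂ → Set
  ⟦ α ⟧≐ c = ∀ σ → ValueSubst σ → ⟦ α [ σ ]ᵃ ⟧ ≈ℂ c

  data _≋_ : Term 𝒮 → Term 𝒮 → Set where
    ≋-refl  : ∀ {t} → t ≋ t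
    ≋-sym   : ∀ {s t} → s ≋ t → t ≋ s
    ≋-trans : ∀ {s t u} → s ≋ t → t ≋ u → s ≋ u

    app-cong : ∀ b ts i {s t} → s ≋ t → app b (ts [ i ]≔ s) ≋ app b (ts [ i ]≔ t)
    •-cong   : ∀ α {s t} → s ≋ t → α • s ≋ α • t
    ⊕-congˡ  : ∀ u {s t} → s ≋ t → s ⊕ u ≋ t ⊕ u
    ⊕-congʳ  : ∀ u {s t} → s ≋ t → u ⊕ s ≋ u ⊕ t

    ⊕-comm    : ∀ t₁ t₂ → t₁ ⊕ t₂ ≋ t₂ ⊕ t₁
    ⊕-assoc   : ∀ t₁ t₂ t₃ → t₁ ⊕ (t₂ ⊕ t₃) ≋ (t₁ ⊕ t₂) ⊕ t₃
    ⊕-null    : ∀ s α t → ⟦ α ⟧≐ 0ℂ → s ⊕ (α • t) ≋ s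
    •-unit    : ∀ α t → ⟦ α ⟧≐ 1ℂ → α • t ≋ t
    •-•       : ∀ α β t → α • (β • t) ≋ (α ·ᵃ β) • t
    •-distrib : ∀ α t₁ t₂ → α • (t₁ ⊕ t₂) ≋ (α • t₁) ⊕ (α • t₂)
    •-merge   : ∀ α β t → (α • t) ⊕ (β • t) ≋ (α +ᵃ β) • t
    app-•     : ∀ b ts i α t → app b (ts [ i ]≔ (α • t)) ≋ α • app b (ts [ i ]≔ t)
    app-⊕     : ∀ b ts i t₁ t₂ →
                app b (ts [ i ]≔ (t₁ ⊕ t₂)) ≋ app b (ts [ i ]≔ t₁) ⊕ app b (ts [ i ]≔ t₂)

  -- ⨁ α t ∈ CAN.
  record Canonical {n} (α : Fin (suc n) → Amp 𝒮) (t : Fin (suc n) → Term 𝒮) : Set where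
    field
      classical : ∀ i → Classical (t i)
      distinct  : ∀ i j → i ≢ j → t i ≢ t j
      nonNull   : ∀ i → ¬ (⟦ α i ⟧≐ 0ℂ)

  infix 4 _⊴_

  data _⊴_ (u : Term 𝒮) : Term 𝒮 → Set where
    here    : u ⊴ u
    in-app  : ∀ b {ts} i → u ⊴ lookup ts i → u ⊴ app b ts
    in-•    : ∀ α {t} → u ⊴ t → u ⊴ α • t
    in-⊕ˡ   : ∀ {s t} → u ⊴ s → u ⊴ s ⊕ t
    in-⊕ʳ   : ∀ {s t} → u ⊴ t → u ⊴ s ⊕ t

  -- A non-variable subterm of l unifies with l′; two independent substitutions
  -- account for renaming the variables apart.
  Overlap : Term 𝒮 → Term 𝒮 → Set
  Overlap l l′ = ∃ λ u → u ⊴ l × (∀ x → u ≢ var x) ×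
                 ∃ λ (σ : Subst) → ∃ λ (τ : Subst) → u [ σ ] ≡ l′ [ τ ]

  data ECtx : Set where
    ◇   : ECtx
    -- The entry of ts at position i is immaterial: it is overwritten on plugging.
    app : (b : Sym 𝒮) (i : Fin (ar 𝒮 b)) (ts : Vec (Term 𝒮) (ar 𝒮 b)) →
          (∀ j → j < i → Value (lookup ts j)) → ECtx → ECtx

  plug : ECtx → Term 𝒮 → Term 𝒮
  plug ◇                t = t
  plug (app b i ts _ E) t = app b (ts [ i ]≔ plug E t)

  -- Contexts with holes numbered by Fin k, in any order.
  data HoleCtx (k : ℕ) : Set where
    hole : Fin k → HoleCtx k
    var  : Var → HoleCtx k
    app  : (b : Sym 𝒮) → Vec (HoleCtx k) (ar 𝒮 b) → HoleCtx k
    _•_  : Amp 𝒮 → HoleCtx k → HoleCtx k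
    _⊕_  : HoleCtx k → HoleCtx k → HoleCtx k

  fill  : ∀ {k} → HoleCtx k → (Fin k → Term 𝒮) → Term 𝒮
  fill* : ∀ {k n} → Vec (HoleCtx k) n → (Fin k → Term 𝒮) → Vec (Term 𝒮) n
  fill (hole i)   s = s i
  fill (var x)    s = var x
  fill (app b Cs) s = app b (fill* Cs s)
  fill (α • C)    s = α • fill C s
  fill (C ⊕ D)    s = fill C s ⊕ fill D s
  fill* []        s = []
  fill* (C ∷ Cs)  s = fill C s ∷ fill* Cs s

  occ  : ∀ {k} → Fin k → HoleCtx k → ℕ
  occ* : ∀ {k n} → Fin k → Vec (HoleCtx k) n → ℕ
  occ i (hole j) with i ≟ᶠ j
  ... | yes _ = 1
  ... | no  _ = 0
  occ i (var x)    = 0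
  occ i (app b Cs) = occ* i Cs
  occ i (α • C)    = occ i C
  occ i (C ⊕ D)    = occ i C ℕ.+ occ i D
  occ* i []        = 0
  occ* i (C ∷ Cs)  = occ i C ℕ.+ occ* i Cs

  -- The partial map δ⊥ as a relation: δ⊥ s t d means that δ⊥(s,t) is defined
  -- and equal to d. Hole zero is the one filled with ∣q⟩, resp. ∣1-q⟩.
  data δ⊥ : Term 𝒮 → Term 𝒮 → ℂ → Set where
    same : ∀ {t} → Classical t → δ⊥ t t 1ℂ
    diff : ∀ {n} (C : HoleCtx (suc n)) (q : Bool) (s t : Fin (suc n) → Term 𝒮) →
           (∀ i → occ i C ≡ 1) → s zero ≡ ket q → t zero ≡ ket (not q) →
           Classical (fill C s) → Classical (fill C t) →
           δ⊥ (fill C s) (fill C t) 0ℂ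

record STRS (𝒮 : Signature) : Set₁ where
  open Signature 𝒮
  field
    Rule    : Term 𝒮 → Term 𝒮 → Set
    main    : FunSym
    lhs     : ∀ {l r} → Rule l r → ∃ λ f → ∃ λ ps → l ≡ fun f ps × All Pattern ps
    var⊆    : ∀ {l r} → Rule l r → vars r ⊆ vars l
    linear  : ∀ {l r} → Rule l r → Unique (vars l)
    nonOverlapping : ∀ {l r l′ r′} → Rule l r → Rule l′ r′ →
                     ¬ (l ≡ l′ × r ≡ r′) → ¬ Overlap l l′

module _ {𝒮 : Signature} (ℜ : STRS 𝒮) where
  open Signature 𝒮
  open STRS ℜ

  infix 4 _↦_ _⟶_ _⟶?_ _⟶*_

  data _↦_ : Term 𝒮 → Term 𝒮 → Set where
    fire : ∀ {l r} (E : ECtx) (σ : Subst) → Rule l r → ValueSubst σ →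
           Classical (plug E (l [ σ ])) → Ground (plug E (l [ σ ])) →
           plug E (l [ σ ]) ↦ plug E (r [ σ ])

  -- The premise "sᵢ is a normal form" of rule (Q) refers negatively to the
  -- relation being defined. As sᵢ is classical there, ≡ is the identity on it
  -- and (C) is the only rule that can reduce it, so normality of sᵢ is
  -- stratified as the absence of a (C)-step.
  data _⟶_ : Term 𝒮 → Term 𝒮 → Set
  data _⟶?_ : Term 𝒮 → Term 𝒮 → Set

  data _⟶_ where
    C : ∀ {s t} → s ↦ t → s ⟶ t
    E : ∀ {s s′ t′ t} → Ground s → Ground t → s ≋ s′ → s′ ⟶ t′ → t′ ≋ t → s ⟶ t
    Q : ∀ {n} (α : Fin (suc n) → Amp 𝒮) (s t : Fin (suc n) → Term 𝒮) →
        Ground (⨁ α s) → Canonical α s →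
        (∀ i → s i ⟶? t i) → (∃ λ i → s i ⟶ t i) →
        ⨁ α s ⟶ ⨁ α t

  data _⟶?_ where
    stay : ∀ {s} → ¬ (∃ λ t → s ↦ t) → s ⟶? s
    step : ∀ {s t} → s ⟶ t → s ⟶? t

  _⟶*_ : Term 𝒮 → Term 𝒮 → Set
  _⟶*_ = Star _⟶_

  NF : Term 𝒮 → Set
  NF s = Ground s × ¬ (∃ λ t → s ⟶ t)

  Ctx : Set
  Ctx = List (Var × Ty 𝒮)

  Dom : Ctx → List Var
  Dom = map proj₁

  -- t ⟶* u where ⨁ α v, with classical values vᵢ, is a canonical form of u.
  record Evaluates {n} (t : Term 𝒮) (α : Fin (suc n) → Amp 𝒮) (v : Fin (suc n) → Term 𝒮) : Set where
    field
      {reduct}  : Term 𝒮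
      reduces   : t ⟶* reduct
      equiv     : reduct ≋ ⨁ α v
      ground    : Ground (⨁ α v)
      canonical : Canonical α v
      values    : ∀ i → Value (v i)

  -- In this block ⊢ᵥ v ∶ T stands for the typing of closed values through which
  -- Sub₀ depends on the typing judgment itself.
  module _ (⊢ᵥ_∶_ : Term 𝒮 → Ty 𝒮 → Set) where

    Sub₀ : Ctx → Subst → Set
    Sub₀ Θ σ = ValueSubst σ × (∀ {x T} → (x , T) ∈ Θ → ⊢ᵥ σ x ∶ T)

    -- s ⊥ t in context Θ = Γ ∪ Δ. A type-nat variable occurring in an amplitude of
    -- s or t only ranges over numerals Sⁿ(0): for other values of type nat, such
    -- as 1·0, the instance of the amplitude is not an amplitude.
    Orthogonal : Ctx → Term 𝒮 → Term 𝒮 → Set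
    Orthogonal Θ s t =
      ∀ σ → Sub₀ Θ σ →
      (∀ x → x ∈ ampVars s ++ ampVars t → (x , nat) ∈ Θ →
         ∃ λ ι → varsⁿ ι ≡ [] × σ x ≡ natTerm ι) →
      ∃ λ n → ∃ λ m →
      ∃ λ (α : Fin (suc n) → Amp 𝒮) → ∃ λ (v : Fin (suc n) → Term 𝒮) →
      ∃ λ (β : Fin (suc m) → Amp 𝒮) → ∃ λ (w : Fin (suc m) → Term 𝒮) →
      ∃ λ (d : Fin (suc n) → Fin (suc m) → ℂ) →
        Evaluates (s [ σ ]) α v ×
        Evaluates (t [ σ ]) β w ×
        (∀ i j → δ⊥ (v i) (w j) (d i j)) ×
        ∑ℂ (λ i → ∑ℂ (λ j → ⟦ α i ⟧ *ℂ conj ⟦ β j ⟧ *ℂ d i j)) ≈ℂ 0ℂ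

    data Typing  : Ctx → Ctx → Term 𝒮 → Ty 𝒮 → Set
    data AmpTyping : Ctx → Amp 𝒮 → Set

    data AmpTyping where
      amp : ∀ {Γ} a ιs → (∀ i → Typing Γ [] (natTerm (lookup ιs i)) nat) → AmpTyping Γ (amp a ιs)
      mul : ∀ {Γ α β} → AmpTyping Γ α → AmpTyping Γ β → AmpTyping Γ (α ·ᵃ β)
      add : ∀ {Γ α β} → AmpTyping Γ α → AmpTyping Γ β → AmpTyping Γ (α +ᵃ β)

    data Typing where
      varᶜ  : ∀ {Γ x T} → Unique (Dom Γ) → (x , T) ∈ Γ → IsClassicalType 𝒮 T →
              Typing Γ [] (var x) T
      varᑫ  : ∀ {Γ x T} → Unique (Dom (Γ ++ (x , T) ∷ [])) → Quantum 𝒮 T →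
              Typing Γ ((x , T) ∷ []) (var x) T
      equiv : ∀ {Γ Δ s t T} → Typing Γ Δ s T → s ≋ t → vars t ⊆ Dom (Γ ++ Δ) →
              Typing Γ Δ t T
      symb  : ∀ {Γ Δ} b (Δs : Vec Ctx (ar 𝒮 b)) ts →
              Unique (Dom (Γ ++ Δ)) → Δ ↭ List.concat (Vec.toList Δs) →
              (∀ i → Typing Γ (lookup Δs i) (lookup ts i) (lookup (dom 𝒮 b) i)) →
              Typing Γ Δ (app b ts) (cod 𝒮 b)
      sup   : ∀ {Γ Δ T n} (α : Fin (suc n) → Amp 𝒮) (t : Fin (suc n) → Term 𝒮) →
              Quantum 𝒮 T →
              (∀ i → Typing Γ Δ (t i) T) →
              (∀ i → AmpTyping Γ (α i)) →
              (∀ σ → Sub₀ Γ σ → ∑ℝ (λ i → ∣ ⟦ α i [ σ ]ᵃ ⟧ ∣²) ≈ℝ 1ℝ) →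
              (∀ i j → i ≢ j → Orthogonal (Γ ++ Δ) (t i) (t j)) →
              Typing Γ Δ (⨁ α t) T

  -- A derivation of ∅;∅ ⊢ t : T has only judgments with empty contexts in it, and
  -- Sub₀ ∅ does not consult the typing of values, so closed typing can be
  -- defined first, with any relation in place of ⊢ᵥ; it then serves as ⊢ᵥ.
  ClosedTyping : Term 𝒮 → Ty 𝒮 → Set
  ClosedTyping = Typing (λ _ _ → ⊥) [] []

  infix 4 _︔_⊢_∶_ ⊢_∶_ _⊥ₜ_

  _︔_⊢_∶_ : Ctx → Ctx → Term 𝒮 → Ty 𝒮 → Set
  _︔_⊢_∶_ = Typing ClosedTyping

  ⊢_∶_ : Term 𝒮 → Ty 𝒮 → Set
  ⊢ t ∶ T = [] ︔ [] ⊢ t ∶ T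

  _⊥ₜ_ : Term 𝒮 → Term 𝒮 → Set
  s ⊥ₜ t = Orthogonal ClosedTyping [] s t

  In : (b : Sym 𝒮) → Vec (Term 𝒮) (ar 𝒮 b) → Set
  In b vs = All Value vs × (∀ i → ⊢ lookup vs i ∶ lookup (dom 𝒮 b) i)

  Isometry : FunSym → Set
  Isometry f = ∀ vs ws → In (inj₂ f) vs → In (inj₂ f) ws →
               (∃ λ i → lookup vs i ⊥ₜ lookup ws i) → fun f vs ⊥ₜ fun f ws

  record IsQTRS : Set where
    field
      isometries     : ∀ f → Isometry f
      typePreserving : ∀ {l r} → Rule l r → ∀ Γ Δ T → Γ ︔ Δ ⊢ l ∶ T → Γ ︔ Δ ⊢ r ∶ T

  Total : Set
  Total = ∀ f vs → In (inj₂ f) vs →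
          ∃ λ (σ : Subst) → ∃ λ l → ∃ λ r →
          ValueSubst σ × Rule l r × l [ σ ] ≡ fun f vs

  WellTyped : Term 𝒮 → Set
  WellTyped t = ∃ λ T → ⊢ t ∶ T

{-# OPTIONS --safe #-}
module Submission where

-- A term denotes a linear combination of classical terms, and ≡ does not change
-- its coefficients. A reducible term has a nonzero coefficient at a classical
-- term containing a function symbol, while a value has none, so a term
-- equivalent to a value is a normal form.
--
-- Conversely, a closed typing derivation turns t into a linear combination of
-- distinct classical terms, each typed by the symbol signatures alone. By
-- totality such a classical term is either a value or has a redex at an
-- evaluation position. If t is a normal form, rule (Q) forces the amplitude of
-- every reducible component to be null; here equality with 0 in ℂ is stable
-- under double negation, so the nonzero components need not be found
-- effectively. Finally any two null multiples α·s and α·s′ are equivalent, so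
-- that s can be replaced with the value ().

open import Algebra.Bundles using (CommutativeSemiring)
open import Algebra.Structures.Biased using (IsCommutativeMonoidˡ; IsCommutativeSemiringˡ)
open import Data.Fin.Base using (Fin; zero; suc; _<_)
import Data.Fin.Properties as Fin
open import Data.List.Base using (List; []; _∷_; _++_)
import Data.List.Base as List
open import Data.List.Membership.Propositional using (_∈_)
open import Data.List.Membership.Propositional.Properties using (∈-lookup)
open import Data.List.Properties using (++-conicalˡ; ++-conicalʳ)
open import Data.List.Relation.Binary.Permutation.Propositional using (↭-reflexive; ↭-sym)
open import Data.List.Relation.Binary.Permutation.Propositional.Properties using (↭-empty-inv)
open import Data.List.Relation.Binary.Sublist.Propositional using (_⊆_; []; _∷_; _∷ʳ_; minimum)
open import Data.List.Relation.Binary.Sublist.Propositional.Properties using (All-resp-⊆)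
open import Data.List.Relation.Binary.Subset.Propositional.Properties using (⊆[]⇒≡[])
import Data.List.Relation.Unary.All as ListAll
open import Data.List.Relation.Unary.All using ([]; _∷_) renaming (All to Allᴸ)
open import Data.List.Relation.Unary.AllPairs using (AllPairs; []; _∷_)
open import Data.List.Relation.Unary.Any as Any using (here; there)
open import Data.List.Relation.Unary.Any.Properties using (lookup-index)
open import Data.Nat.Base as ℕ using (ℕ; zero; suc)
import Data.Nat.Properties as ℕ
open import Data.Product.Base using (∃; _×_; _,_; proj₁; proj₂)
open import Data.Rational.Base as ℚ using (ℚ; 0ℚ; 1ℚ; ½; Positive; NonZero)
import Data.Rational.Properties as ℚ
open import Data.Rational.Solver using (module +-*-Solver)
open import Data.Sum.Base using (_⊎_; inj₁; inj₂)
import Data.Sum.Properties as Sum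
open import Data.Vec.Base as Vec using (Vec; []; _∷_; lookup; _[_]≔_)
import Data.Vec.Properties as Vec
open import Data.Vec.Relation.Unary.All using (All; []; _∷_)
open import Data.Vec.Relation.Unary.All.Properties using (lookup⁻)
open import Function.Base using (_∘_; case_of_)
open import Function.Bundles using (_⇔_; mk⇔; module Injection)
open import Level using (0ℓ)
open import Relation.Binary.Definitions using (DecidableEquality)
open import Relation.Binary.PropositionalEquality using (_≡_; _≢_; refl; sym; trans; cong; cong₂; subst)
import Relation.Binary.Reasoning.Setoid as SetoidReasoning
open import Relation.Binary.Structures using (IsEquivalence)
open import Relation.Nullary using (¬_; Dec; yes; no; contradiction)
open import Relation.Nullary.Decidable using (_×-dec_; decidable-stable; map′; toWitnessFalse; ¬¬-excluded-middle)
open import Defs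

-- Constructive real and complex arithmetic

-- Null sequences of rationals. By definition `_≈ℝ_` says that a difference of sequences is one, so
-- congruence and stability of real equality reduce to closure properties of null sequences.
record Vanishing (f : ℕ → ℚ) : Set where
  constructor mkVanishing
  field
    eventually : (ε : ℚ) .{{_ : Positive ε}} → ∃ λ N → ∀ n → N ℕ.≤ n → ℚ.∣ f n ∣ ℚ.< ε

open Vanishing

vanishing-ext : ∀ {f g} → (∀ n → f n ≡ g n) → Vanishing f → Vanishing g
eventually (vanishing-ext f≗g f→0) ε = let N , f< = eventually f→0 ε in
  N , λ n n≥ → subst (λ q → ℚ.∣ q ∣ ℚ.< ε) (f≗g n) (f< n n≥)

vanishing-0 : Vanishing (λ _ → 0ℚ)
eventually vanishing-0 ε = 0 , λ _ _ → ℚ.positive⁻¹ ε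

vanishing-neg : ∀ {f} → Vanishing f → Vanishing (λ n → ℚ.- f n)
eventually (vanishing-neg {f} f→0) ε = let N , f< = eventually f→0 ε in
  N , λ n n≥ → subst (ℚ._< ε) (sym (ℚ.∣-p∣≡∣p∣ (f n))) (f< n n≥)

vanishing-+ : ∀ {f g} → Vanishing f → Vanishing g → Vanishing (λ n → f n ℚ.+ g n)
eventually (vanishing-+ {f} {g} f→0 g→0) ε =
  bound (eventually f→0 (half ε) {{half-pos ε}}) (eventually g→0 (half ε) {{half-pos ε}})
  where
  open ℚ.≤-Reasoning
  bound : (∃ λ M → ∀ n → M ℕ.≤ n → ℚ.∣ f n ∣ ℚ.< half ε) →
          (∃ λ N → ∀ n → N ℕ.≤ n → ℚ.∣ g n ∣ ℚ.< half ε) →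
          ∃ λ N → ∀ n → N ℕ.≤ n → ℚ.∣ f n ℚ.+ g n ∣ ℚ.< ε
  bound (M , f<) (N , g<) = M ℕ.+ N , λ n n≥ → begin-strict
    ℚ.∣ f n ℚ.+ g n ∣          ≤⟨ ℚ.∣p+q∣≤∣p∣+∣q∣ (f n) (g n) ⟩
    ℚ.∣ f n ∣ ℚ.+ ℚ.∣ g n ∣    <⟨ ℚ.+-mono-< (f< n (ℕ.m+n≤o⇒m≤o M n≥)) (g< n (ℕ.m+n≤o⇒n≤o M n≥)) ⟩
    half ε ℚ.+ half ε          ≡⟨ half+half ε ⟩
    ε                          ∎

∣*∣-bound : ∀ p q B ε .{{_ : Positive B}} .{{_ : NonZero B}} →
            ℚ.∣ q ∣ ℚ.≤ B → ℚ.∣ p ∣ ℚ.< ε ℚ.* ℚ.1/ B → ℚ.∣ p ℚ.* q ∣ ℚ.< ε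
∣*∣-bound p q B ε q≤ p< = begin-strict
  ℚ.∣ p ℚ.* q ∣           ≡⟨ ℚ.∣p*q∣≡∣p∣*∣q∣ p q ⟩
  ℚ.∣ p ∣ ℚ.* ℚ.∣ q ∣     ≤⟨ ℚ.*-monoˡ-≤-nonNeg ℚ.∣ p ∣ {{abs-nonNeg p}} q≤ ⟩
  ℚ.∣ p ∣ ℚ.* B           <⟨ ℚ.*-monoˡ-<-pos B p< ⟩
  (ε ℚ.* ℚ.1/ B) ℚ.* B    ≡⟨ ℚ.*-assoc ε (ℚ.1/ B) B ⟩
  ε ℚ.* (ℚ.1/ B ℚ.* B)    ≡⟨ cong (ε ℚ.*_) (ℚ.*-inverseˡ B) ⟩
  ε ℚ.* 1ℚ                ≡⟨ ℚ.*-identityʳ ε ⟩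
  ε                       ∎
  where open ℚ.≤-Reasoning

vanishing-*-bounded : ∀ {f g : ℕ → ℚ} B .{{_ : Positive B}} N → (∀ n → N ℕ.≤ n → ℚ.∣ g n ∣ ℚ.≤ B) →
                      Vanishing f → Vanishing (λ n → f n ℚ.* g n)
eventually (vanishing-*-bounded {f} {g} B {{B>0}} N g≤ f→0) ε = bound
  (eventually f→0 (ε ℚ.* ℚ.1/ B) {{ℚ.pos*pos⇒pos ε (ℚ.1/ B) {{ℚ.1/pos⇒pos B}}}})
  where
  instance
    B≢0 : NonZero B
    B≢0 = ℚ.pos⇒nonZero B
  bound : (∃ λ M → ∀ n → M ℕ.≤ n → ℚ.∣ f n ∣ ℚ.< ε ℚ.* ℚ.1/ B) →
          ∃ λ M → ∀ n → M ℕ.≤ n → ℚ.∣ f n ℚ.* g n ∣ ℚ.< ε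
  bound (M , f<) = M ℕ.+ N , λ n n≥ → ∣*∣-bound (f n) (g n) B ε
    (g≤ n (ℕ.m+n≤o⇒n≤o M n≥)) (f< n (ℕ.m+n≤o⇒m≤o M n≥))

-- A Cauchy sequence is eventually bounded, and a bounded factor does not disturb convergence to 0.
vanishing-* : ∀ {f} → Vanishing f → (x : ℝ) → Vanishing (λ n → f n ℚ.* seq x n)
vanishing-* f→0 x = vanishing-*-bounded {g = seq x} (ℚ.∣ seq x N ∣ ℚ.+ 1ℚ)
  {{ℚ.nonNeg+pos⇒pos ℚ.∣ seq x N ∣ {{abs-nonNeg (seq x N)}} 1ℚ}} N (proj₂ (eventually-bounded x)) f→0
  where
  N : ℕ
  N = proj₁ (eventually-bounded x)

≈ℝ⇒vanishing : ∀ {x y} → x ≈ℝ y → Vanishing (λ n → seq x n ℚ.- seq y n)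
eventually (≈ℝ⇒vanishing (mk≈ℝ x≈y)) ε = x≈y ε

vanishing⇒≈ℝ : ∀ {x y} → Vanishing (λ n → seq x n ℚ.- seq y n) → x ≈ℝ y
vanishing⇒≈ℝ x-y→0 = mk≈ℝ λ ε → eventually x-y→0 ε

≈ℝ-pointwise : ∀ {x y} → (∀ n → seq x n ≡ seq y n) → x ≈ℝ y
≈ℝ-pointwise {x} {y} x≗y = vanishing⇒≈ℝ (vanishing-ext
  (λ n → sym (trans (cong (ℚ._- seq y n) (x≗y n)) (ℚ.+-inverseʳ (seq y n)))) vanishing-0)

module _ where
  open +-*-Solver

  neg-sub : ∀ a b → ℚ.- (a ℚ.- b) ≡ b ℚ.- a
  neg-sub = solve 2 (λ a b → :- (a :- b) := b :- a) refl

  sub-trans : ∀ a b c → (a ℚ.- b) ℚ.+ (b ℚ.- c) ≡ a ℚ.- c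
  sub-trans = solve 3 (λ a b c → (a :- b) :+ (b :- c) := a :- c) refl

  sub-+ : ∀ a a′ b b′ → (a ℚ.- a′) ℚ.+ (b ℚ.- b′) ≡ (a ℚ.+ b) ℚ.- (a′ ℚ.+ b′)
  sub-+ = solve 4 (λ a a′ b b′ → (a :- a′) :+ (b :- b′) := (a :+ b) :- (a′ :+ b′)) refl

  sub-* : ∀ a a′ b b′ → (a ℚ.- a′) ℚ.* b ℚ.+ (b ℚ.- b′) ℚ.* a′ ≡ a ℚ.* b ℚ.- a′ ℚ.* b′
  sub-* = solve 4 (λ a a′ b b′ → (a :- a′) :* b :+ (b :- b′) :* a′ := a :* b :- a′ :* b′) refl

  add-sub : ∀ a b → a ≡ b ℚ.+ (a ℚ.- b)
  add-sub = solve 2 (λ a b → a := b :+ (a :- b)) refl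

≈ℝ-sym : ∀ {x y} → x ≈ℝ y → y ≈ℝ x
≈ℝ-sym {x} {y} x≈y = vanishing⇒≈ℝ (vanishing-ext (λ n → neg-sub (seq x n) (seq y n))
  (vanishing-neg (≈ℝ⇒vanishing x≈y)))

≈ℝ-trans : ∀ {x y z} → x ≈ℝ y → y ≈ℝ z → x ≈ℝ z
≈ℝ-trans {x} {y} {z} x≈y y≈z = vanishing⇒≈ℝ (vanishing-ext
  (λ n → sub-trans (seq x n) (seq y n) (seq z n))
  (vanishing-+ (≈ℝ⇒vanishing x≈y) (≈ℝ⇒vanishing y≈z)))

+ℝ-cong : ∀ {x x′ y y′} → x ≈ℝ x′ → y ≈ℝ y′ → x +ℝ y ≈ℝ x′ +ℝ y′
+ℝ-cong {x} {x′} {y} {y′} x≈ y≈ = vanishing⇒≈ℝ (vanishing-ext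
  (λ n → sub-+ (seq x n) (seq x′ n) (seq y n) (seq y′ n))
  (vanishing-+ (≈ℝ⇒vanishing x≈) (≈ℝ⇒vanishing y≈)))

-ℝ-cong : ∀ {x x′} → x ≈ℝ x′ → -ℝ x ≈ℝ -ℝ x′
-ℝ-cong {x} {x′} x≈ = vanishing⇒≈ℝ (vanishing-ext
  (λ n → ℚ.neg-distrib-+ (seq x n) (ℚ.- seq x′ n)) (vanishing-neg (≈ℝ⇒vanishing x≈)))

-- The identity `sub-*` pairs each of the two null differences with the entries of a single real, so
-- that `vanishing-*` applies to both summands.
*ℝ-cong : ∀ {x x′ y y′} → x ≈ℝ x′ → y ≈ℝ y′ → x *ℝ y ≈ℝ x′ *ℝ y′
*ℝ-cong {x} {x′} {y} {y′} x≈ y≈ = vanishing⇒≈ℝ (vanishing-ext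
  (λ n → sub-* (seq x n) (seq x′ n) (seq y n) (seq y′ n))
  (vanishing-+ (vanishing-* (≈ℝ⇒vanishing x≈) y) (vanishing-* (≈ℝ⇒vanishing y≈) x′)))

≤-∣-∣ : ∀ a b → ℚ.∣ a ∣ ℚ.≤ ℚ.∣ b ∣ ℚ.+ ℚ.∣ a ℚ.- b ∣
≤-∣-∣ a b = begin
  ℚ.∣ a ∣                       ≡⟨ cong ℚ.∣_∣ (add-sub a b) ⟩
  ℚ.∣ b ℚ.+ (a ℚ.- b) ∣         ≤⟨ ℚ.∣p+q∣≤∣p∣+∣q∣ b (a ℚ.- b) ⟩
  ℚ.∣ b ∣ ℚ.+ ℚ.∣ a ℚ.- b ∣     ∎
  where open ℚ.≤-Reasoning

∣∣-<-half : ∀ a b ε → ℚ.∣ b ∣ ℚ.< half ε → ℚ.∣ a ℚ.- b ∣ ℚ.< half ε → ℚ.∣ a ∣ ℚ.< ε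
∣∣-<-half a b ε b< a-b< = begin-strict
  ℚ.∣ a ∣                       ≤⟨ ≤-∣-∣ a b ⟩
  ℚ.∣ b ∣ ℚ.+ ℚ.∣ a ℚ.- b ∣     <⟨ ℚ.+-mono-< b< a-b< ⟩
  half ε ℚ.+ half ε             ≡⟨ half+half ε ⟩
  ε                             ∎
  where open ℚ.≤-Reasoning

half-< : ∀ ε .{{_ : Positive ε}} → half ε ℚ.< ε
half-< ε = begin-strict
  half ε                ≡⟨ ℚ.+-identityʳ (half ε) ⟨
  half ε ℚ.+ 0ℚ         <⟨ ℚ.+-monoʳ-< (half ε) (ℚ.positive⁻¹ (half ε) {{half-pos ε}}) ⟩
  half ε ℚ.+ half ε     ≡⟨ half+half ε ⟩
  ε                     ∎
  where open ℚ.≤-Reasoning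

-- Comparing a single late entry with ε / 2 decides whether the sequence can
-- still vanish.
vanishing-stable : ∀ z → ¬ ¬ Vanishing (seq z) → Vanishing (seq z)
eventually (vanishing-stable z ¬¬z→0) ε = close (cauchy z (half h) {{h/2>0}})
  where
  h : ℚ
  h = half ε
  h>0 : Positive h
  h>0 = half-pos ε
  h/2>0 : Positive (half h)
  h/2>0 = half-pos h {{h>0}}

  close : (∃ λ N → ∀ m n → N ℕ.≤ m → N ℕ.≤ n → ℚ.∣ seq z m ℚ.- seq z n ∣ ℚ.< half h) →
          ∃ λ N → ∀ n → N ℕ.≤ n → ℚ.∣ seq z n ∣ ℚ.< ε
  close (N , z-close) = N , λ n n≥ → ∣∣-<-half (seq z n) (seq z N) ε zN<
    (ℚ.<-trans (z-close n N n≥ ℕ.≤-refl) (half-< h {{h>0}}))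
    where
    bound : (∃ λ M → ∀ n → M ℕ.≤ n → ℚ.∣ seq z n ∣ ℚ.< half h) → ℚ.∣ seq z N ∣ ℚ.< h
    bound (M , z<) = ∣∣-<-half (seq z N) (seq z (M ℕ.+ N)) h
      (z< (M ℕ.+ N) (ℕ.m≤m+n M N)) (z-close N (M ℕ.+ N) ℕ.≤-refl (ℕ.m≤n+m N M))
    -- An inequality between two rationals is decidable; this is where the double negation is
    -- removed.
    zN< : ℚ.∣ seq z N ∣ ℚ.< h
    zN< = decidable-stable (ℚ.∣ seq z N ∣ ℚ.<? h)
      (λ ≮h → ¬¬z→0 (λ z→0 → ≮h (bound (eventually z→0 (half h) {{h/2>0}}))))

-- The difference of two reals is again a real, which supplies the Cauchy modulus used by
-- `vanishing-stable`.
≈ℝ-stable : ∀ {x y} → ¬ ¬ (x ≈ℝ y) → x ≈ℝ y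
≈ℝ-stable {x} {y} ¬¬x≈y = vanishing⇒≈ℝ (vanishing-stable (x +ℝ -ℝ y)
  (λ ¬→0 → ¬¬x≈y (λ x≈y → ¬→0 (≈ℝ⇒vanishing x≈y))))

-- Complex numbers as a commutative semiring

≈ℂ-pointwise : ∀ {z w} → (∀ n → seq (re z) n ≡ seq (re w) n) →
               (∀ n → seq (im z) n ≡ seq (im w) n) → z ≈ℂ w
≈ℂ-pointwise {z} {w} re≗ im≗ =
  mk≈ℂ (≈ℝ-pointwise {re z} {re w} re≗) (≈ℝ-pointwise {im z} {im w} im≗)

≈ℂ-refl : ∀ {z} → z ≈ℂ z
≈ℂ-refl {z} = ≈ℂ-pointwise {z} {z} (λ _ → refl) (λ _ → refl)

≈ℂ-sym : ∀ {z w} → z ≈ℂ w → w ≈ℂ z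
≈ℂ-sym (mk≈ℂ r i) = mk≈ℂ (≈ℝ-sym r) (≈ℝ-sym i)

≈ℂ-trans : ∀ {z w u} → z ≈ℂ w → w ≈ℂ u → z ≈ℂ u
≈ℂ-trans (mk≈ℂ r i) (mk≈ℂ r′ i′) = mk≈ℂ (≈ℝ-trans r r′) (≈ℝ-trans i i′)

≈ℂ-stable : ∀ {z w} → ¬ ¬ (z ≈ℂ w) → z ≈ℂ w
≈ℂ-stable ¬¬z≈w = mk≈ℂ (≈ℝ-stable (λ k → ¬¬z≈w (λ z≈w → k (_≈ℂ_.re-≈ z≈w))))
                       (≈ℝ-stable (λ k → ¬¬z≈w (λ z≈w → k (_≈ℂ_.im-≈ z≈w))))

+ℂ-cong : ∀ {z z′ w w′} → z ≈ℂ z′ → w ≈ℂ w′ → z +ℂ w ≈ℂ z′ +ℂ w′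
+ℂ-cong {z} {z′} {w} {w′} (mk≈ℂ r i) (mk≈ℂ r′ i′) =
  mk≈ℂ (+ℝ-cong {re z} {re z′} {re w} {re w′} r r′) (+ℝ-cong {im z} {im z′} {im w} {im w′} i i′)

*ℂ-cong : ∀ {z z′ w w′} → z ≈ℂ z′ → w ≈ℂ w′ → z *ℂ w ≈ℂ z′ *ℂ w′
*ℂ-cong {z} {z′} {w} {w′} (mk≈ℂ r i) (mk≈ℂ r′ i′) = mk≈ℂ
  (+ℝ-cong {re z *ℝ re w} {re z′ *ℝ re w′} { -ℝ (im z *ℝ im w)} { -ℝ (im z′ *ℝ im w′)}
    (*ℝ-cong {re z} {re z′} {re w} {re w′} r r′)
    (-ℝ-cong {im z *ℝ im w} {im z′ *ℝ im w′} (*ℝ-cong {im z} {im z′} {im w} {im w′} i i′)))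
  (+ℝ-cong {re z *ℝ im w} {re z′ *ℝ im w′} {im z *ℝ re w} {im z′ *ℝ re w′}
    (*ℝ-cong {re z} {re z′} {im w} {im w′} r i′)
    (*ℝ-cong {im z} {im z′} {re w} {re w′} i r′))

1ℂ≉0ℂ : ¬ (1ℂ ≈ℂ 0ℂ)
1ℂ≉0ℂ (mk≈ℂ (mk≈ℝ 1≈0) _) = let N , 1<½ = 1≈0 ½ in
  toWitnessFalse {a? = ℚ.∣ 1ℚ ℚ.- 0ℚ ∣ ℚ.<? ½} _ (1<½ N ℕ.≤-refl)

module _ where
  open +-*-Solver

  +ℂ-comm : ∀ z w → z +ℂ w ≈ℂ w +ℂ z
  +ℂ-comm z w = ≈ℂ-pointwise {z +ℂ w} {w +ℂ z}
    (λ n → ℚ.+-comm (seq (re z) n) (seq (re w) n))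
    (λ n → ℚ.+-comm (seq (im z) n) (seq (im w) n))

  +ℂ-assoc : ∀ z w u → (z +ℂ w) +ℂ u ≈ℂ z +ℂ (w +ℂ u)
  +ℂ-assoc z w u = ≈ℂ-pointwise {(z +ℂ w) +ℂ u} {z +ℂ (w +ℂ u)}
    (λ n → ℚ.+-assoc (seq (re z) n) (seq (re w) n) (seq (re u) n))
    (λ n → ℚ.+-assoc (seq (im z) n) (seq (im w) n) (seq (im u) n))

  +ℂ-identityˡ : ∀ z → 0ℂ +ℂ z ≈ℂ z
  +ℂ-identityˡ z = ≈ℂ-pointwise {0ℂ +ℂ z} {z}
    (λ n → ℚ.+-identityˡ (seq (re z) n)) (λ n → ℚ.+-identityˡ (seq (im z) n))

  *ℂ-comm : ∀ z w → z *ℂ w ≈ℂ w *ℂ z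
  *ℂ-comm z w = ≈ℂ-pointwise {z *ℂ w} {w *ℂ z}
    (λ n → solve 4 (λ a b c d → a :* c :+ :- (b :* d) := c :* a :+ :- (d :* b)) refl
      (seq (re z) n) (seq (im z) n) (seq (re w) n) (seq (im w) n))
    (λ n → solve 4 (λ a b c d → a :* d :+ b :* c := c :* b :+ d :* a) refl
      (seq (re z) n) (seq (im z) n) (seq (re w) n) (seq (im w) n))

  *ℂ-assoc : ∀ z w u → (z *ℂ w) *ℂ u ≈ℂ z *ℂ (w *ℂ u)
  *ℂ-assoc z w u = ≈ℂ-pointwise {(z *ℂ w) *ℂ u} {z *ℂ (w *ℂ u)}
    (λ n → solve 6 (λ a b c d e f →
      (a :* c :+ :- (b :* d)) :* e :+ :- ((a :* d :+ b :* c) :* f) :=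
      a :* (c :* e :+ :- (d :* f)) :+ :- (b :* (c :* f :+ d :* e))) refl
      (seq (re z) n) (seq (im z) n) (seq (re w) n) (seq (im w) n) (seq (re u) n) (seq (im u) n))
    (λ n → solve 6 (λ a b c d e f →
      (a :* c :+ :- (b :* d)) :* f :+ (a :* d :+ b :* c) :* e :=
      a :* (c :* f :+ d :* e) :+ b :* (c :* e :+ :- (d :* f))) refl
      (seq (re z) n) (seq (im z) n) (seq (re w) n) (seq (im w) n) (seq (re u) n) (seq (im u) n))

  *ℂ-distribʳ : ∀ z w u → (w +ℂ u) *ℂ z ≈ℂ w *ℂ z +ℂ u *ℂ z
  *ℂ-distribʳ z w u = ≈ℂ-pointwise {(w +ℂ u) *ℂ z} {w *ℂ z +ℂ u *ℂ z}
    (λ n → solve 6 (λ a b c d e f →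
      (c :+ e) :* a :+ :- ((d :+ f) :* b) :=
      (c :* a :+ :- (d :* b)) :+ (e :* a :+ :- (f :* b))) refl
      (seq (re z) n) (seq (im z) n) (seq (re w) n) (seq (im w) n) (seq (re u) n) (seq (im u) n))
    (λ n → solve 6 (λ a b c d e f →
      (c :+ e) :* b :+ (d :+ f) :* a :=
      (c :* b :+ d :* a) :+ (e :* b :+ f :* a)) refl
      (seq (re z) n) (seq (im z) n) (seq (re w) n) (seq (im w) n) (seq (re u) n) (seq (im u) n))

  *ℂ-identityˡ : ∀ z → 1ℂ *ℂ z ≈ℂ z
  *ℂ-identityˡ z = ≈ℂ-pointwise {1ℂ *ℂ z} {z}
    (λ n → solve 2 (λ a b → con 1ℚ :* a :+ :- (con 0ℚ :* b) := a) refl (seq (re z) n) (seq (im z) n))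
    (λ n → solve 2 (λ a b → con 1ℚ :* b :+ con 0ℚ :* a := b) refl (seq (re z) n) (seq (im z) n))

  *ℂ-zeroˡ : ∀ z → 0ℂ *ℂ z ≈ℂ 0ℂ
  *ℂ-zeroˡ z = ≈ℂ-pointwise {0ℂ *ℂ z} {0ℂ}
    (λ n → solve 2 (λ a b → con 0ℚ :* a :+ :- (con 0ℚ :* b) := con 0ℚ) refl (seq (re z) n) (seq (im z) n))
    (λ n → solve 2 (λ a b → con 0ℚ :* b :+ con 0ℚ :* a := con 0ℚ) refl (seq (re z) n) (seq (im z) n))

ℂ-commutativeSemiring : CommutativeSemiring 0ℓ 0ℓ
ℂ-commutativeSemiring = record
  { Carrier = ℂ ; _≈_ = _≈ℂ_ ; _+_ = _+ℂ_ ; _*_ = _*ℂ_ ; 0# = 0ℂ ; 1# = 1ℂ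
  ; isCommutativeSemiring = IsCommutativeSemiringˡ.isCommutativeSemiring record
    { +-isCommutativeMonoid = IsCommutativeMonoidˡ.isCommutativeMonoid record
      { isSemigroup = record
        { isMagma = record { isEquivalence = ≈ℂ-isEquivalence ; ∙-cong = +ℂ-cong }
        ; assoc   = +ℂ-assoc }
      ; identityˡ = +ℂ-identityˡ ; comm = +ℂ-comm }
    ; *-isCommutativeMonoid = IsCommutativeMonoidˡ.isCommutativeMonoid record
      { isSemigroup = record
        { isMagma = record { isEquivalence = ≈ℂ-isEquivalence ; ∙-cong = *ℂ-cong }
        ; assoc   = *ℂ-assoc }
      ; identityˡ = *ℂ-identityˡ ; comm = *ℂ-comm }
    ; distribʳ = *ℂ-distribʳ ; zeroˡ = *ℂ-zeroˡ } }
  where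
  ≈ℂ-isEquivalence : IsEquivalence _≈ℂ_
  ≈ℂ-isEquivalence = record { refl = ≈ℂ-refl ; sym = ≈ℂ-sym ; trans = ≈ℂ-trans }

module _ {𝒮 : Signature} where
  open Signature 𝒮

  -- Decidable equality of symbols: comparing tags first leaves only the
  -- diagonal cases to be matched.

  tagᵗ : Ty 𝒮 → ℕ
  tagᵗ 𝟙        = 0
  tagᵗ Qbit     = 1
  tagᵗ nat      = 2
  tagᵗ (list _) = 3
  tagᵗ (_ ⊗ _)  = 4
  tagᵗ (base _) = 5

  infix 4 _≟ᵗ_ _≟ᶜ_ _≟ˢ_

  _≟ᵗ_ : DecidableEquality (Ty 𝒮)
  sameTagᵗ : (T U : Ty 𝒮) → tagᵗ T ≡ tagᵗ U → Dec (T ≡ U)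
  T ≟ᵗ U with tagᵗ T ℕ.≟ tagᵗ U
  ... | yes eq = sameTagᵗ T U eq
  ... | no neq = no (neq ∘ cong tagᵗ)
  sameTagᵗ 𝟙        𝟙          refl = yes refl
  sameTagᵗ Qbit     Qbit       refl = yes refl
  sameTagᵗ nat      nat        refl = yes refl
  sameTagᵗ (list T) (list T′)  refl = map′ (cong list) (λ { refl → refl }) (T ≟ᵗ T′)
  sameTagᵗ (T ⊗ U)  (T′ ⊗ U′)  refl =
    map′ (λ { (refl , refl) → refl }) (λ { refl → refl , refl }) (T ≟ᵗ T′ ×-dec U ≟ᵗ U′)
  sameTagᵗ (base B) (base B′)  refl =
    map′ (cong base ∘ Injection.injective BaseType-countable) (λ { refl → refl })
      (Injection.to BaseType-countable B ℕ.≟ Injection.to BaseType-countable B′)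

  tagᶜ : Con 𝒮 → ℕ
  tagᶜ unit       = 0
  tagᶜ ket₀       = 1
  tagᶜ ket₁       = 2
  tagᶜ O          = 3
  tagᶜ S          = 4
  tagᶜ (pair _ _) = 5
  tagᶜ (nil _)    = 6
  tagᶜ (cons _)   = 7
  tagᶜ (con _)    = 8

  _≟ᶜ_ : DecidableEquality (Con 𝒮)
  sameTagᶜ : (c d : Con 𝒮) → tagᶜ c ≡ tagᶜ d → Dec (c ≡ d)
  c ≟ᶜ d with tagᶜ c ℕ.≟ tagᶜ d
  ... | yes eq = sameTagᶜ c d eq
  ... | no neq = no (neq ∘ cong tagᶜ)
  sameTagᶜ unit       unit         refl = yes refl
  sameTagᶜ ket₀       ket₀         refl = yes refl
  sameTagᶜ ket₁       ket₁         refl = yes refl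
  sameTagᶜ O          O            refl = yes refl
  sameTagᶜ S          S            refl = yes refl
  sameTagᶜ (pair T U) (pair T′ U′) refl =
    map′ (λ { (refl , refl) → refl }) (λ { refl → refl , refl }) (T ≟ᵗ T′ ×-dec U ≟ᵗ U′)
  sameTagᶜ (nil T)    (nil T′)     refl = map′ (cong nil) (λ { refl → refl }) (T ≟ᵗ T′)
  sameTagᶜ (cons T)   (cons T′)    refl = map′ (cong cons) (λ { refl → refl }) (T ≟ᵗ T′)
  sameTagᶜ (con c)    (con c′)     refl = map′ (cong con) (λ { refl → refl }) (c ≟Con c′)

  _≟ˢ_ : DecidableEquality (Sym 𝒮)
  _≟ˢ_ = Sum.≡-dec _≟ᶜ_ _≟Fun_

  -- Function symbols below symbols

  data HasFun : Term 𝒮 → Set where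
    here : ∀ f ts → HasFun (fun f ts)
    arg  : ∀ b ts i → HasFun (lookup ts i) → HasFun (app b ts)

  value-hasNoFun : ∀ {v} → Value v → ¬ HasFun v
  value-hasNoFun (con c vs) (arg _ _ i h) = args vs i h
    where
    args : ∀ {n} {vs : Vec (Term 𝒮) n} → All Value vs → ∀ i → ¬ HasFun (lookup vs i)
    args (v ∷ _)  zero    h = value-hasNoFun v h
    args (_ ∷ vs) (suc i) h = args vs i h

  plug-hasFun : ∀ K {t : Term 𝒮} → HasFun t → HasFun (plug K t)
  plug-hasFun ◇                h = h
  plug-hasFun (app b i ts _ K) h =
    arg b _ i (subst HasFun (sym (Vec.lookup∘update i ts _)) (plug-hasFun K h))

  -- A left-hand side is headed by a function symbol and so are its instances. Evaluation contexts
  -- consist of symbols only, so `HasFun`, which looks below symbols, finds it.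
  ↦-hasFun : ∀ {ℜ : STRS 𝒮} {s t} → _↦_ ℜ s t → HasFun s
  ↦-hasFun {ℜ} (fire K σ rule _ _ _) with STRS.lhs ℜ rule
  ... | f , ps , refl , _ = plug-hasFun K (here f (ps [ σ ]*))

  ↦-classical : ∀ {ℜ : STRS 𝒮} {s t} → _↦_ ℜ s t → Classical s
  ↦-classical (fire _ _ _ _ cl _) = cl

  -- Ground terms and amplitudes

  groundⁿ-subst : ∀ σ (ι : NatExp 𝒮) → varsⁿ ι ≡ [] → substⁿ σ ι ≡ ι
  groundⁿ-subst σ O     _ = refl
  groundⁿ-subst σ (S ι) g = cong S (groundⁿ-subst σ ι g)

  groundⁿ*-subst : ∀ {n} σ (ιs : Vec (NatExp 𝒮) n) →
                   List.concatMap varsⁿ (Vec.toList ιs) ≡ [] → Vec.map (substⁿ σ) ιs ≡ ιs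
  groundⁿ*-subst σ []       g = refl
  groundⁿ*-subst σ (ι ∷ ιs) g = cong₂ _∷_
    (groundⁿ-subst σ ι (++-conicalˡ (varsⁿ ι) _ g)) (groundⁿ*-subst σ ιs (++-conicalʳ (varsⁿ ι) _ g))

  groundAmp-subst : ∀ σ (α : Amp 𝒮) → GroundAmp α → α [ σ ]ᵃ ≡ α
  groundAmp-subst σ (amp a ιs) g = cong (amp a) (groundⁿ*-subst σ ιs g)
  groundAmp-subst σ (α ·ᵃ β)   g = cong₂ _·ᵃ_ (groundAmp-subst σ α (++-conicalˡ (varsᵃ α) _ g))
                                              (groundAmp-subst σ β (++-conicalʳ (varsᵃ α) _ g))
  groundAmp-subst σ (α +ᵃ β)   g = cong₂ _+ᵃ_ (groundAmp-subst σ α (++-conicalˡ (varsᵃ α) _ g))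
                                              (groundAmp-subst σ β (++-conicalʳ (varsᵃ α) _ g))

  ⨁-groundAmp : ∀ {n} (α : Fin (suc n) → Amp 𝒮) t → Ground (⨁ α t) → ∀ i → GroundAmp (α i)
  ⨁-groundAmp {zero}  α t g zero    = ++-conicalˡ (varsᵃ (α zero)) _ g
  ⨁-groundAmp {suc n} α t g zero    = ++-conicalˡ (varsᵃ (α zero)) _ (++-conicalˡ _ _ g)
  ⨁-groundAmp {suc n} α t g (suc i) =
    ⨁-groundAmp (α ∘ suc) (t ∘ suc) (++-conicalʳ (varsᵃ (α zero) ++ vars (t zero)) _ g) i

-- Coefficients

-- What the invariance of coefficients under `≋` uses about amplitudes. The abstract semiring keeps
-- Cauchy sequences out of the computations.
record Scalars (𝒮 : Signature) : Set₁ where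
  field
    commutativeSemiring : CommutativeSemiring 0ℓ 0ℓ
  open CommutativeSemiring commutativeSemiring public
  field
    eval   : Amp 𝒮 → Carrier
    eval-· : ∀ α β → eval (α ·ᵃ β) ≈ eval α * eval β
    eval-+ : ∀ α β → eval (α +ᵃ β) ≈ eval α + eval β
    eval-0 : ∀ α → ⟦ α ⟧≐ 0ℂ → eval α ≈ 0#
    eval-1 : ∀ α → ⟦ α ⟧≐ 1ℂ → eval α ≈ 1#

module Coefficients {𝒮 : Signature} (R : Scalars 𝒮) where
  open Scalars R hiding (refl; sym; trans; zero)
  open CommutativeSemiring commutativeSemiring using () renaming (refl to ≈-refl; sym to ≈-sym; trans to ≈-trans)
  open SetoidReasoning setoid

  *-leftComm : ∀ a b c → a * (b * c) ≈ b * (a * c)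
  *-leftComm a b c = begin
    a * (b * c)  ≈⟨ *-assoc a b c ⟨
    (a * b) * c  ≈⟨ *-congʳ (*-comm a b) ⟩
    (b * a) * c  ≈⟨ *-assoc b a c ⟩
    b * (a * c)  ∎

  indicator : ∀ {P : Set} → Dec P → Carrier
  indicator (yes _) = 1#
  indicator (no  _) = 0#

  -- The coefficient of the classical term u in the linear combination of
  -- classical terms denoted by t; variables count as classical atoms.
  coeff    : Term 𝒮 → Term 𝒮 → Carrier
  coeffApp : ∀ {b c} → Dec (b ≡ c) → Vec (Term 𝒮) (ar 𝒮 b) → Vec (Term 𝒮) (ar 𝒮 c) → Carrier
  coeff*   : ∀ {n} → Vec (Term 𝒮) n → Vec (Term 𝒮) n → Carrier
  coeff (var x)    (var y)    = indicator (x ℕ.≟ y)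
  coeff (var x)    (app _ _)  = 0#
  coeff (var x)    (_ • _)    = 0#
  coeff (var x)    (_ ⊕ _)    = 0#
  coeff (app b ts) (var _)    = 0#
  coeff (app b ts) (app c us) = coeffApp (b ≟ˢ c) ts us
  coeff (app b ts) (_ • _)    = 0#
  coeff (app b ts) (_ ⊕ _)    = 0#
  coeff (α • t)    u          = eval α * coeff t u
  coeff (s ⊕ t)    u          = coeff s u + coeff t u
  coeffApp (yes refl) ts us = coeff* ts us
  coeffApp (no _)     ts us = 0#
  coeff* []       []       = 1#
  coeff* (t ∷ ts) (u ∷ us) = coeff t u * coeff* ts us

  coeffApp-shape : ∀ {b c} (d : Dec (b ≡ c)) us → (∀ ts → coeffApp d ts us ≡ 0#) ⊎
                   ∃ λ us′ → ∀ ts → coeffApp d ts us ≡ coeff* ts us′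
  coeffApp-shape (yes refl) us = inj₂ (us , λ _ → refl)
  coeffApp-shape (no _)     us = inj₁ λ _ → refl

  -- For a fixed `u` the coefficient is, uniformly in the arguments, either zero or a product of
  -- coefficients of arguments. Both are linear in each argument, which is what the three clauses of
  -- `≋` about symbols need.
  coeff-app-shape : ∀ b u → (∀ ts → coeff (app b ts) u ≡ 0#) ⊎
                    ∃ λ us → ∀ ts → coeff (app b ts) u ≡ coeff* ts us
  coeff-app-shape b (var _)    = inj₁ λ _ → refl
  coeff-app-shape b (app c us) = coeffApp-shape (b ≟ˢ c) us
  coeff-app-shape b (_ • _)    = inj₁ λ _ → refl
  coeff-app-shape b (_ ⊕ _)    = inj₁ λ _ → refl

  coeff*-cong : ∀ {n} (ts : Vec (Term 𝒮) n) i {s t} → (∀ u → coeff s u ≈ coeff t u) →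
                ∀ us → coeff* (ts [ i ]≔ s) us ≈ coeff* (ts [ i ]≔ t) us
  coeff*-cong (_ ∷ _)  zero    s≈t (u ∷ _)  = *-congʳ (s≈t u)
  coeff*-cong (_ ∷ ts) (suc i) s≈t (_ ∷ us) = *-congˡ (coeff*-cong ts i s≈t us)

  coeff*-• : ∀ {n} (ts : Vec (Term 𝒮) n) i α t us →
             coeff* (ts [ i ]≔ (α • t)) us ≈ eval α * coeff* (ts [ i ]≔ t) us
  coeff*-• (_ ∷ _)  zero    α t (u ∷ us) = *-assoc (eval α) (coeff t u) _
  coeff*-• (s ∷ ts) (suc i) α t (u ∷ us) = ≈-trans (*-congˡ (coeff*-• ts i α t us)) (*-leftComm _ _ _)

  coeff*-⊕ : ∀ {n} (ts : Vec (Term 𝒮) n) i t₁ t₂ us →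
             coeff* (ts [ i ]≔ (t₁ ⊕ t₂)) us ≈ coeff* (ts [ i ]≔ t₁) us + coeff* (ts [ i ]≔ t₂) us
  coeff*-⊕ (_ ∷ _)  zero    t₁ t₂ (u ∷ us) = distribʳ _ (coeff t₁ u) (coeff t₂ u)
  coeff*-⊕ (s ∷ ts) (suc i) t₁ t₂ (u ∷ us) = ≈-trans (*-congˡ (coeff*-⊕ ts i t₁ t₂ us)) (distribˡ _ _ _)

  -- Each generator of `≋` is a law of coefficients: sums and scalars obey the semiring laws,
  -- `⊕-null` and `•-unit` are `eval-0` and `eval-1`, and symbols are multilinear because `coeff*`
  -- is a product.
  coeff-≋ : ∀ {s t} → s ≋ t → ∀ u → coeff s u ≈ coeff t u
  coeff-≋ ≋-refl          u = ≈-refl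
  coeff-≋ (≋-sym e)       u = ≈-sym (coeff-≋ e u)
  coeff-≋ (≋-trans e e′)  u = ≈-trans (coeff-≋ e u) (coeff-≋ e′ u)
  coeff-≋ (app-cong b ts i {s} {t} e) u with coeff-app-shape b u
  ... | inj₁ vanish     = reflexive (trans (vanish _) (sym (vanish _)))
  ... | inj₂ (us , eq) = begin
    coeff (app b (ts [ i ]≔ s)) u  ≡⟨ eq _ ⟩
    coeff* (ts [ i ]≔ s) us        ≈⟨ coeff*-cong ts i (coeff-≋ e) us ⟩
    coeff* (ts [ i ]≔ t) us        ≡⟨ eq _ ⟨
    coeff (app b (ts [ i ]≔ t)) u  ∎
  coeff-≋ (•-cong α e)    u = *-congˡ (coeff-≋ e u)
  coeff-≋ (⊕-congˡ _ e)   u = +-congʳ (coeff-≋ e u)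
  coeff-≋ (⊕-congʳ _ e)   u = +-congˡ (coeff-≋ e u)
  coeff-≋ (⊕-comm s t)    u = +-comm _ _
  coeff-≋ (⊕-assoc r s t) u = ≈-sym (+-assoc _ _ _)
  coeff-≋ (⊕-null s α t α≐0) u = begin
    coeff s u + eval α * coeff t u  ≈⟨ +-congˡ (*-congʳ (eval-0 α α≐0)) ⟩
    coeff s u + 0# * coeff t u      ≈⟨ +-congˡ (zeroˡ _) ⟩
    coeff s u + 0#                  ≈⟨ +-identityʳ _ ⟩
    coeff s u                       ∎
  coeff-≋ (•-unit α t α≐1) u = ≈-trans (*-congʳ (eval-1 α α≐1)) (*-identityˡ _)
  coeff-≋ (•-• α β t)      u = ≈-trans (≈-sym (*-assoc _ _ _)) (*-congʳ (≈-sym (eval-· α β)))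
  coeff-≋ (•-distrib α s t) u = distribˡ _ _ _
  coeff-≋ (•-merge α β t)  u = ≈-trans (≈-sym (distribʳ _ _ _)) (*-congʳ (≈-sym (eval-+ α β)))
  coeff-≋ (app-• b ts i α t) u with coeff-app-shape b u
  ... | inj₁ vanish     = begin
    coeff (app b (ts [ i ]≔ (α • t))) u     ≡⟨ vanish _ ⟩
    0#                                      ≈⟨ zeroʳ _ ⟨
    eval α * 0#                             ≡⟨ cong (eval α *_) (vanish _) ⟨
    eval α * coeff (app b (ts [ i ]≔ t)) u  ∎
  ... | inj₂ (us , eq) = begin
    coeff (app b (ts [ i ]≔ (α • t))) u     ≡⟨ eq _ ⟩
    coeff* (ts [ i ]≔ (α • t)) us           ≈⟨ coeff*-• ts i α t us ⟩
    eval α * coeff* (ts [ i ]≔ t) us        ≡⟨ cong (eval α *_) (eq _) ⟨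
    eval α * coeff (app b (ts [ i ]≔ t)) u  ∎
  coeff-≋ (app-⊕ b ts i t₁ t₂) u with coeff-app-shape b u
  ... | inj₁ vanish     = begin
    coeff (app b (ts [ i ]≔ (t₁ ⊕ t₂))) u                            ≡⟨ vanish _ ⟩
    0#                                                               ≈⟨ +-identityˡ 0# ⟨
    0# + 0#                                                          ≡⟨ cong₂ _+_ (vanish _) (vanish _) ⟨
    coeff (app b (ts [ i ]≔ t₁)) u + coeff (app b (ts [ i ]≔ t₂)) u  ∎
  ... | inj₂ (us , eq) = begin
    coeff (app b (ts [ i ]≔ (t₁ ⊕ t₂))) u                            ≡⟨ eq _ ⟩
    coeff* (ts [ i ]≔ (t₁ ⊕ t₂)) us                                  ≈⟨ coeff*-⊕ ts i t₁ t₂ us ⟩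
    coeff* (ts [ i ]≔ t₁) us + coeff* (ts [ i ]≔ t₂) us              ≡⟨ cong₂ _+_ (eq _) (eq _) ⟨
    coeff (app b (ts [ i ]≔ t₁)) u + coeff (app b (ts [ i ]≔ t₂)) u  ∎

  -- Under a constructor, either the head symbols differ or some factor of the product is null by
  -- induction; scalings and sums preserve 0.
  coeff-value-hasFun : ∀ {v u} → Value v → HasFun u → coeff v u ≈ 0#
  coeff*-value-hasFun : ∀ {n} {vs : Vec (Term 𝒮) n} → All Value vs →
                        ∀ us i → HasFun (lookup us i) → coeff* vs us ≈ 0#
  coeff-value-hasFun (con c vs) (here f ts) with inj₁ c ≟ˢ inj₂ f
  ... | no _ = ≈-refl
  coeff-value-hasFun (con c vs) (arg b us i h) with inj₁ c ≟ˢ b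
  ... | yes refl = coeff*-value-hasFun vs us i h
  ... | no _     = ≈-refl
  coeff-value-hasFun (scale _ v)        h = ≈-trans (*-congˡ (coeff-value-hasFun v h)) (zeroʳ _)
  coeff-value-hasFun (plus v w)         h =
    ≈-trans (+-cong (coeff-value-hasFun v h) (coeff-value-hasFun w h)) (+-identityˡ _)
  coeff*-value-hasFun (v ∷ _)  (_ ∷ _)  zero    h = ≈-trans (*-congʳ (coeff-value-hasFun v h)) (zeroˡ _)
  coeff*-value-hasFun (_ ∷ vs) (_ ∷ us) (suc i) h = ≈-trans (*-congˡ (coeff*-value-hasFun vs us i h)) (zeroʳ _)

  -- Equality is decided along with the coefficient, so the same induction also yields a decision
  -- procedure for equality with a classical term.
  coeff-classical : ∀ {s} → Classical s → ∀ u →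
                    (s ≡ u × coeff s u ≈ 1#) ⊎ (s ≢ u × coeff s u ≈ 0#)
  coeff*-classical : ∀ {n} {ss : Vec (Term 𝒮) n} → All Classical ss → ∀ us →
                     (ss ≡ us × coeff* ss us ≈ 1#) ⊎ (ss ≢ us × coeff* ss us ≈ 0#)
  coeff-classical (var x) (var y) with x ℕ.≟ y
  ... | yes refl = inj₁ (refl , ≈-refl)
  ... | no x≢y   = inj₂ ((λ { refl → x≢y refl }) , ≈-refl)
  coeff-classical (var x) (app _ _) = inj₂ ((λ ()) , ≈-refl)
  coeff-classical (var x) (_ • _)   = inj₂ ((λ ()) , ≈-refl)
  coeff-classical (var x) (_ ⊕ _)   = inj₂ ((λ ()) , ≈-refl)
  coeff-classical (app b cs) (var _) = inj₂ ((λ ()) , ≈-refl)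
  coeff-classical (app b cs) (app c us) with b ≟ˢ c
  ... | no b≢c = inj₂ ((λ { refl → b≢c refl }) , ≈-refl)
  ... | yes refl with coeff*-classical cs us
  ...   | inj₁ (eq , ≈1)  = inj₁ (cong (app b) eq , ≈1)
  ...   | inj₂ (neq , ≈0) = inj₂ ((λ { refl → neq refl }) , ≈0)
  coeff-classical (app b cs) (_ • _) = inj₂ ((λ ()) , ≈-refl)
  coeff-classical (app b cs) (_ ⊕ _) = inj₂ ((λ ()) , ≈-refl)
  coeff*-classical []       []       = inj₁ (refl , ≈-refl)
  coeff*-classical (c ∷ cs) (u ∷ us) with coeff-classical c u
  ... | inj₂ (neq , ≈0) = inj₂ ((λ { refl → neq refl }) , ≈-trans (*-congʳ ≈0) (zeroˡ _))
  ... | inj₁ (refl , ≈1) with coeff*-classical cs us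
  ...   | inj₁ (eq , ≈1′)  = inj₁ (cong (_ ∷_) eq , ≈-trans (*-cong ≈1 ≈1′) (*-identityˡ _))
  ...   | inj₂ (neq , ≈0) = inj₂ ((λ { refl → neq refl }) , ≈-trans (*-congˡ ≈0) (zeroʳ _))

  coeff-classical-self : ∀ {s} → Classical s → coeff s s ≈ 1#
  coeff-classical-self {s} c with coeff-classical c s
  ... | inj₁ (_ , ≈1)  = ≈1
  ... | inj₂ (neq , _) = contradiction refl neq

  coeff-classical-other : ∀ {s u} → Classical s → s ≢ u → coeff s u ≈ 0#
  coeff-classical-other {u = u} c s≢u with coeff-classical c u
  ... | inj₁ (eq , _) = contradiction eq s≢u
  ... | inj₂ (_ , ≈0) = ≈0

  coeff-⨁-other : ∀ {n} (α : Fin (suc n) → Amp 𝒮) s u →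
                  (∀ i → Classical (s i)) → (∀ i → s i ≢ u) → coeff (⨁ α s) u ≈ 0#
  coeff-⨁-other {zero}  α s u cl s≢u = ≈-trans (*-congˡ (coeff-classical-other (cl zero) (s≢u zero))) (zeroʳ _)
  coeff-⨁-other {suc n} α s u cl s≢u = ≈-trans
    (+-cong (≈-trans (*-congˡ (coeff-classical-other (cl zero) (s≢u zero))) (zeroʳ _))
            (coeff-⨁-other (α ∘ suc) (s ∘ suc) u (cl ∘ suc) (s≢u ∘ suc)))
    (+-identityˡ _)

  -- Only the summand `i` contributes, since the others carry different classical terms.
  coeff-⨁ : ∀ {n} (α : Fin (suc n) → Amp 𝒮) s → (∀ i → Classical (s i)) →
            (∀ i j → i ≢ j → s i ≢ s j) → ∀ i → coeff (⨁ α s) (s i) ≈ eval (α i)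
  coeff-⨁ {zero}  α s cl ds zero    = ≈-trans (*-congˡ (coeff-classical-self (cl zero))) (*-identityʳ _)
  coeff-⨁ {suc n} α s cl ds zero    = ≈-trans
    (+-cong (≈-trans (*-congˡ (coeff-classical-self (cl zero))) (*-identityʳ _))
            (coeff-⨁-other (α ∘ suc) (s ∘ suc) (s zero) (cl ∘ suc) (λ i → ds (suc i) zero (λ ()))))
    (+-identityʳ _)
  coeff-⨁ {suc n} α s cl ds (suc i) = ≈-trans
    (+-cong (≈-trans (*-congˡ (coeff-classical-other (cl zero) (ds zero (suc i) (λ ())))) (zeroʳ _))
            (coeff-⨁ (α ∘ suc) (s ∘ suc) (cl ∘ suc) (λ j k j≢k → ds (suc j) (suc k) (j≢k ∘ Fin.suc-injective)) i))
    (+-identityˡ _)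

  -- Irreducibility of terms equivalent to values

  module _ (ℜ : STRS 𝒮) (1≉0 : ¬ (1# ≈ 0#))
           (eval-ground : ∀ α → GroundAmp α → eval α ≈ 0# → ⟦ α ⟧≐ 0ℂ) where

    -- Rule (C) reduces a classical term, whose coefficient at itself is 1, and rule (E) preserves
    -- coefficients. In rule (Q) the witness found for the classical term `s i` can only be `s i`
    -- itself, and its coefficient in the canonical form is the non-null `α i`.
    ⟶-hasFun : ∀ {s t} → _⟶_ ℜ s t → ∃ λ u → HasFun u × ¬ (coeff s u ≈ 0#)
    ⟶-hasFun {s} (C s↦t) = s , ↦-hasFun s↦t ,
      λ ≈0 → 1≉0 (≈-trans (≈-sym (coeff-classical-self (↦-classical s↦t))) ≈0)
    ⟶-hasFun (E _ _ s≋s′ s′⟶t′ _) with ⟶-hasFun s′⟶t′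
    ... | u , h , ≉0 = u , h , λ ≈0 → ≉0 (≈-trans (≈-sym (coeff-≋ s≋s′ u)) ≈0)
    ⟶-hasFun (Q α s t g can _ (i , si⟶ti)) with ⟶-hasFun si⟶ti
    ... | u , h , ≉0 with coeff-classical (Canonical.classical can i) u
    ...   | inj₂ (_ , ≈0)   = contradiction ≈0 ≉0
    ...   | inj₁ (refl , _) = u , h , λ ≈0 → nonNull i
      (eval-ground (α i) (⨁-groundAmp α s g i) (≈-trans (≈-sym (coeff-⨁ α s classical distinct i)) ≈0))
      where open Canonical can

    value-irreducible : ∀ {s v} → Value v → s ≋ v → ¬ ∃ (_⟶_ ℜ s)
    value-irreducible val s≋v (_ , s⟶t) with ⟶-hasFun s⟶t
    ... | u , h , ≉0 = ≉0 (≈-trans (coeff-≋ s≋v u) (coeff-value-hasFun val h))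

-- Evaluation of amplitudes in ℂ

module _ (𝒮 : Signature) where

  zeroSubst : Subst {𝒮}
  zeroSubst _ = app (inj₁ O) []

  zeroSubst-value : ValueSubst zeroSubst
  zeroSubst-value _ = con O []

  -- Any value substitution would do; it only serves to evaluate the non-ground
  -- amplitudes which may occur in the middle of a chain of equivalences.
  ℂ-scalars : Scalars 𝒮
  ℂ-scalars = record
    { commutativeSemiring = ℂ-commutativeSemiring
    ; eval     = λ α → ⟦ α [ zeroSubst ]ᵃ ⟧
    ; eval-·   = λ _ _ → ≈ℂ-refl
    ; eval-+   = λ _ _ → ≈ℂ-refl
    ; eval-0   = λ α α≐0 → α≐0 zeroSubst zeroSubst-value
    ; eval-1   = λ α α≐1 → α≐1 zeroSubst zeroSubst-value
    }

  -- Substitution leaves a ground amplitude unchanged, so one instance settles them all.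
  ℂ-eval-ground : ∀ α → GroundAmp α → ⟦ α [ zeroSubst ]ᵃ ⟧ ≈ℂ 0ℂ → ⟦ α ⟧≐ 0ℂ
  ℂ-eval-ground α g ≈0 σ _ = subst (λ β → ⟦ β ⟧ ≈ℂ 0ℂ)
    (trans (groundAmp-subst zeroSubst α g) (sym (groundAmp-subst σ α g))) ≈0

-- Allows a case distinction on an undecided property of finitely many items whenever the goal is a
-- negation.
¬¬-Dec-all : ∀ {A : Set} {P : A → Set} (xs : List A) → ¬ ¬ Allᴸ (Dec ∘ P) xs
¬¬-Dec-all []       k = k []
¬¬-Dec-all (x ∷ xs) k = ¬¬-excluded-middle (λ d → ¬¬-Dec-all xs (λ ds → k (d ∷ ds)))

-- Groundness of instances, contexts and sums

module _ {𝒮 : Signature} where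

  ground-args : ∀ {n} (ts : Vec (Term 𝒮) n) → (∀ i → Ground (lookup ts i)) → vars* ts ≡ []
  ground-args []       g = refl
  ground-args (t ∷ ts) g = cong₂ _++_ (g zero) (ground-args ts (g ∘ suc))

  groundⁿ*-lookup : ∀ {n} (ιs : Vec (NatExp 𝒮) n) → (∀ i → varsⁿ (lookup ιs i) ≡ []) →
                    List.concatMap varsⁿ (Vec.toList ιs) ≡ []
  groundⁿ*-lookup []       g = refl
  groundⁿ*-lookup (ι ∷ ιs) g = cong₂ _++_ (g zero) (groundⁿ*-lookup ιs (g ∘ suc))

  value-ground : ∀ {v : Term 𝒮} → Value v → Ground v
  values-ground : ∀ {n} {vs : Vec (Term 𝒮) n} → All Value vs → vars* vs ≡ []
  value-ground (con c vs)   = values-ground vs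
  value-ground (scale gα v) = cong₂ _++_ gα (value-ground v)
  value-ground (plus v w)   = cong₂ _++_ (value-ground v) (value-ground w)
  values-ground []       = refl
  values-ground (v ∷ vs) = cong₂ _++_ (value-ground v) (values-ground vs)

  toNatExp-ground : ∀ {v : Term 𝒮} → Value v → varsⁿ (toNatExp v) ≡ []
  toNatExp-ground (con unit _)       = refl
  toNatExp-ground (con ket₀ _)       = refl
  toNatExp-ground (con ket₁ _)       = refl
  toNatExp-ground (con O _)          = refl
  toNatExp-ground (con S (v ∷ []))   = toNatExp-ground v
  toNatExp-ground (con (pair _ _) _) = refl
  toNatExp-ground (con (nil _) _)    = refl
  toNatExp-ground (con (cons _) _)   = refl
  toNatExp-ground (con (con _) _)    = refl
  toNatExp-ground (scale _ _)        = refl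
  toNatExp-ground (plus _ _)         = refl

  module _ {σ : Subst {𝒮}} (σ-val : ValueSubst σ) where

    substⁿ-ground : ∀ ι → varsⁿ (substⁿ σ ι) ≡ []
    substⁿ-ground (nvar x) = toNatExp-ground (σ-val x)
    substⁿ-ground O        = refl
    substⁿ-ground (S ι)    = substⁿ-ground ι

    substᵃ-ground : ∀ α → GroundAmp (α [ σ ]ᵃ)
    substᵃ-ground (amp a ιs) = groundⁿ*-lookup (Vec.map (substⁿ σ) ιs)
      (λ i → trans (cong varsⁿ (Vec.lookup-map i (substⁿ σ) ιs)) (substⁿ-ground (lookup ιs i)))
    substᵃ-ground (α ·ᵃ β)   = cong₂ _++_ (substᵃ-ground α) (substᵃ-ground β)
    substᵃ-ground (α +ᵃ β)   = cong₂ _++_ (substᵃ-ground α) (substᵃ-ground β)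

    subst-ground  : ∀ t → Ground (t [ σ ])
    subst*-ground : ∀ {n} (ts : Vec (Term 𝒮) n) → vars* (ts [ σ ]*) ≡ []
    subst-ground (var x)    = value-ground (σ-val x)
    subst-ground (app b ts) = subst*-ground ts
    subst-ground (α • t)    = cong₂ _++_ (substᵃ-ground α) (subst-ground t)
    subst-ground (s ⊕ t)    = cong₂ _++_ (subst-ground s) (subst-ground t)
    subst*-ground []       = refl
    subst*-ground (t ∷ ts) = cong₂ _++_ (subst-ground t) (subst*-ground ts)

  update-ground⁻ : ∀ {n} (ts : Vec (Term 𝒮) n) i {s} → vars* (ts [ i ]≔ s) ≡ [] → Ground s
  update-ground⁻ (_ ∷ _)  zero    {s} g = ++-conicalˡ (vars s) _ g
  update-ground⁻ (t ∷ ts) (suc i)     g = update-ground⁻ ts i (++-conicalʳ (vars t) _ g)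

  update-ground : ∀ {n} (ts : Vec (Term 𝒮) n) i {s t} →
                  vars* (ts [ i ]≔ s) ≡ [] → Ground t → vars* (ts [ i ]≔ t) ≡ []
  update-ground (_ ∷ _)  zero    {s} g gt = cong₂ _++_ gt (++-conicalʳ (vars s) _ g)
  update-ground (r ∷ ts) (suc i)     g gt =
    cong₂ _++_ (++-conicalˡ (vars r) _ g) (update-ground ts i (++-conicalʳ (vars r) _ g) gt)

  plug-ground : ∀ K {s t : Term 𝒮} → Ground (plug K s) → Ground t → Ground (plug K t)
  plug-ground ◇                _ gt = gt
  plug-ground (app b i ts _ K) g gt = update-ground ts i g (plug-ground K (update-ground⁻ ts i g) gt)

  ⨁-ground : ∀ {n} (α : Fin (suc n) → Amp 𝒮) t →
             (∀ i → GroundAmp (α i)) → (∀ i → Ground (t i)) → Ground (⨁ α t)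
  ⨁-ground {zero}  α t gα gt = cong₂ _++_ (gα zero) (gt zero)
  ⨁-ground {suc n} α t gα gt =
    cong₂ _++_ (cong₂ _++_ (gα zero) (gt zero)) (⨁-ground (α ∘ suc) (t ∘ suc) (gα ∘ suc) (gt ∘ suc))

  -- Classical ground terms typed by symbol signatures alone

  infix 4 _∶ᶜ_

  data _∶ᶜ_ : Term 𝒮 → Ty 𝒮 → Set where
    app : ∀ b {ts} → (∀ i → lookup ts i ∶ᶜ lookup (dom 𝒮 b) i) → app b ts ∶ᶜ cod 𝒮 b

  ∶ᶜ-classical : ∀ {s T} → s ∶ᶜ T → Classical s
  ∶ᶜ-classical (app b tys) = app b (lookup⁻ (λ i → ∶ᶜ-classical (tys i)))

  ∶ᶜ-ground : ∀ {s T} → s ∶ᶜ T → Ground s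
  ∶ᶜ-ground (app b {ts} tys) = ground-args ts (λ i → ∶ᶜ-ground (tys i))

  -- Decomposition into linear combinations

  data LinComb (P : Term 𝒮 → Set) : Term 𝒮 → Set where
    atom : ∀ {α s} → GroundAmp α → P s → LinComb P (α • s)
    _⊕_  : ∀ {s t} → LinComb P s → LinComb P t → LinComb P (s ⊕ t)

  EquivLinComb : (Term 𝒮 → Set) → Term 𝒮 → Set
  EquivLinComb P t = ∃ λ u → LinComb P u × t ≋ u

  -- The signature need not contain an amplitude of value 1, so that a single
  -- classical term is not in general a linear combination.
  Decomposable : (Term 𝒮 → Set) → Term 𝒮 → Set
  Decomposable P t = (∃ λ s → P s × t ≋ s) ⊎ EquivLinComb P t

  decomposable-resp-≋ : ∀ {P s t} → t ≋ s → Decomposable P s → Decomposable P t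
  decomposable-resp-≋ t≋s (inj₁ (u , p , s≋u)) = inj₁ (u , p , ≋-trans t≋s s≋u)
  decomposable-resp-≋ t≋s (inj₂ (u , l , s≋u)) = inj₂ (u , l , ≋-trans t≋s s≋u)

  ⊕-cong : ∀ {s s′ t t′ : Term 𝒮} → s ≋ s′ → t ≋ t′ → s ⊕ t ≋ s′ ⊕ t′
  ⊕-cong {s′ = s′} {t = t} e e′ = ≋-trans (⊕-congˡ t e) (⊕-congʳ s′ e′)

  scale-linComb : ∀ {P α u} → GroundAmp α → LinComb P u → EquivLinComb P (α • u)
  scale-linComb {α = α} gα (atom {β} {s} gβ p) =
    (α ·ᵃ β) • s , atom (cong₂ _++_ gα gβ) p , •-• α β s
  scale-linComb {α = α} gα (_⊕_ {s} {t} l l′) with scale-linComb gα l | scale-linComb gα l′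
  ... | u , lu , e | u′ , lu′ , e′ = u ⊕ u′ , (lu ⊕ lu′) , ≋-trans (•-distrib α s t) (⊕-cong e e′)

  scale-decomposable : ∀ {P α t} → GroundAmp α → Decomposable P t → EquivLinComb P (α • t)
  scale-decomposable {α = α} gα (inj₁ (s , p , t≋s)) = α • s , atom gα p , •-cong α t≋s
  scale-decomposable {α = α} gα (inj₂ (u , l , t≋u)) with scale-linComb gα l
  ... | u′ , l′ , e = u′ , l′ , ≋-trans (•-cong α t≋u) e

  ⨁-linComb : ∀ {P n} (α : Fin (suc n) → Amp 𝒮) t → (∀ i → GroundAmp (α i)) →
              (∀ i → Decomposable P (t i)) → EquivLinComb P (⨁ α t)
  ⨁-linComb {n = zero}  α t gα dec = scale-decomposable (gα zero) (dec zero)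
  ⨁-linComb {n = suc n} α t gα dec
    with scale-decomposable (gα zero) (dec zero) | ⨁-linComb (α ∘ suc) (t ∘ suc) (gα ∘ suc) (dec ∘ suc)
  ... | u , l , e | u′ , l′ , e′ = u ⊕ u′ , (l ⊕ l′) , ⊕-cong e e′

  -- The clauses of `≋` about symbols, for an arbitrary map in place of `app b`. This generality is
  -- what `fixHead` needs: once its first argument is fixed, `app b` is no longer of the form
  -- `app c`.
  record Multilinear {n} (F : Vec (Term 𝒮) n → Term 𝒮) : Set where
    field
      congruent   : ∀ ts i {s t} → s ≋ t → F (ts [ i ]≔ s) ≋ F (ts [ i ]≔ t)
      homogeneous : ∀ ts i α t → F (ts [ i ]≔ (α • t)) ≋ α • F (ts [ i ]≔ t)
      additive    : ∀ ts i t₁ t₂ → F (ts [ i ]≔ (t₁ ⊕ t₂)) ≋ F (ts [ i ]≔ t₁) ⊕ F (ts [ i ]≔ t₂)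

  open Multilinear

  app-multilinear : ∀ b → Multilinear (app b)
  app-multilinear b = record { congruent = app-cong b ; homogeneous = app-• b ; additive = app-⊕ b }

  fixHead : ∀ {n} {F : Vec (Term 𝒮) (suc n) → Term 𝒮} → Multilinear F → ∀ s → Multilinear (λ ts → F (s ∷ ts))
  fixHead ml s = record
    { congruent   = λ ts i → congruent ml (s ∷ ts) (suc i)
    ; homogeneous = λ ts i → homogeneous ml (s ∷ ts) (suc i)
    ; additive    = λ ts i → additive ml (s ∷ ts) (suc i)
    }

  -- Induction on the number of arguments: the first one is expanded, and each of its terms is held
  -- fixed while the others are expanded. The predicate `P` depends on the position because the
  -- arguments have different types.
  multilinear-decomposable :
    ∀ {n} {P : Fin n → Term 𝒮 → Set} {R : Term 𝒮 → Set} {F} → Multilinear F →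
    (∀ ss → (∀ i → P i (lookup ss i)) → R (F ss)) →
    ∀ ts → (∀ i → Decomposable (P i) (lookup ts i)) → Decomposable R (F ts)
  multilinear-decomposable {F = F} ml R-F [] dec = inj₁ (F [] , R-F [] (λ ()) , ≋-refl)
  multilinear-decomposable {P = P} {R} {F} ml R-F (t ∷ ts) dec = expand (dec zero)
    where
    fixed : ∀ {s} → P zero s → Decomposable R (F (s ∷ ts))
    fixed {s} p = multilinear-decomposable (fixHead ml s)
      (λ ss ps → R-F (s ∷ ss) λ { zero → p ; (suc i) → ps i }) ts (dec ∘ suc)

    expandLinComb : ∀ {u} → LinComb (P zero) u → EquivLinComb R (F (u ∷ ts))
    expandLinComb (atom {α} {s} gα p) with scale-decomposable gα (fixed p)
    -- The head `t` of the vector is immaterial here: the update at `zero` overwrites it.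
    ... | v , l , e = v , l , ≋-trans (homogeneous ml (t ∷ ts) zero α s) e
    expandLinComb (_⊕_ {u₁} {u₂} l₁ l₂) with expandLinComb l₁ | expandLinComb l₂
    ... | v₁ , l₁′ , e₁ | v₂ , l₂′ , e₂ =
      v₁ ⊕ v₂ , (l₁′ ⊕ l₂′) , ≋-trans (additive ml (t ∷ ts) zero u₁ u₂) (⊕-cong e₁ e₂)

    expand : Decomposable (P zero) t → Decomposable R (F (t ∷ ts))
    expand (inj₁ (s , p , t≋s)) = decomposable-resp-≋ (congruent ml (t ∷ ts) zero t≋s) (fixed p)
    expand (inj₂ (u , l , t≋u)) =
      decomposable-resp-≋ (congruent ml (t ∷ ts) zero t≋u) (inj₂ (expandLinComb l))

  -- Closed typing derivations

  natTerm-vars : ∀ (ι : NatExp 𝒮) → Ground (natTerm ι) → varsⁿ ι ≡ []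
  natTerm-vars O     _ = refl
  natTerm-vars (S ι) g = natTerm-vars ι (++-conicalˡ (vars (natTerm ι)) [] g)

  module _ (ℜ : STRS 𝒮) {V : Term 𝒮 → Ty 𝒮 → Set} where

    concat-empty : ∀ {n} (Δs : Vec (Ctx ℜ) n) → List.concat (Vec.toList Δs) ≡ [] → ∀ i → lookup Δs i ≡ []
    concat-empty (Δ ∷ Δs) eq zero    = ++-conicalˡ Δ _ eq
    concat-empty (Δ ∷ Δs) eq (suc i) = concat-empty Δs (++-conicalʳ Δ _ eq) i

    -- Emptiness of the contexts is expressed by equations because the pieces into which `symb`
    -- splits an empty context are only provably empty. For `equiv` the side condition on variables
    -- gives the claim directly.
    closed-ground : ∀ {Γ Δ t T} → Typing ℜ V Γ Δ t T → Γ ≡ [] → Δ ≡ [] → Ground t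
    closed-amp-ground : ∀ {Γ α} → AmpTyping ℜ V Γ α → Γ ≡ [] → GroundAmp α
    closed-ground (varᶜ _ () _) refl _
    closed-ground (equiv _ _ vs⊆) refl refl = ⊆[]⇒≡[] vs⊆
    closed-ground (symb b Δs ts _ Δ↭ tys) refl refl = ground-args ts
      (λ i → closed-ground (tys i) refl (concat-empty Δs (↭-empty-inv (↭-sym Δ↭)) i))
    closed-ground (sup α t _ tys αs _ _) refl refl =
      ⨁-ground α t (λ i → closed-amp-ground (αs i) refl) (λ i → closed-ground (tys i) refl refl)
    closed-amp-ground (amp a ιs tys) refl =
      groundⁿ*-lookup ιs (λ i → natTerm-vars (lookup ιs i) (closed-ground (tys i) refl refl))
    closed-amp-ground (mul α β) refl = cong₂ _++_ (closed-amp-ground α refl) (closed-amp-ground β refl)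
    closed-amp-ground (add α β) refl = cong₂ _++_ (closed-amp-ground α refl) (closed-amp-ground β refl)

    -- Being decomposable is invariant under `≋`, which handles `equiv`; `symb` is multilinear
    -- expansion, and `sup` is a linear combination of decomposable terms with ground amplitudes.
    closed-decomposable : ∀ {Γ Δ t T} → Typing ℜ V Γ Δ t T → Γ ≡ [] → Δ ≡ [] → Decomposable (_∶ᶜ T) t
    closed-decomposable (varᶜ _ () _) refl _
    closed-decomposable (equiv ty s≋t _) refl refl =
      decomposable-resp-≋ (≋-sym s≋t) (closed-decomposable ty refl refl)
    closed-decomposable (symb b Δs ts _ Δ↭ tys) refl refl =
      multilinear-decomposable (app-multilinear b) (λ _ → app b) ts
        (λ i → closed-decomposable (tys i) refl (concat-empty Δs (↭-empty-inv (↭-sym Δ↭)) i))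
    closed-decomposable (sup α t _ tys αs _ _) refl refl = inj₂
      (⨁-linComb α t (λ i → closed-amp-ground (αs i) refl) (λ i → closed-decomposable (tys i) refl refl))

    concat-replicate-[] : ∀ n → List.concat (Vec.toList (Vec.replicate {A = Ctx ℜ} n [])) ≡ []
    concat-replicate-[] zero    = refl
    concat-replicate-[] (suc n) = concat-replicate-[] n

    -- Needed to place classical value arguments in `In`, where totality applies.
    ∶ᶜ-typing : ∀ {s T} → s ∶ᶜ T → Typing ℜ V [] [] s T
    ∶ᶜ-typing (app b {ts} tys) = symb b (Vec.replicate _ []) ts []
      (↭-reflexive (sym (concat-replicate-[] (ar 𝒮 b))))
      (λ i → subst (λ Δ → Typing ℜ V [] Δ (lookup ts i) (lookup (dom 𝒮 b) i))
        (sym (Vec.lookup-replicate i [])) (∶ᶜ-typing (tys i)))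

  -- Collecting equal classical terms

  Summand : Set
  Summand = Amp 𝒮 × Term 𝒮

  -- The first summand is separate since there is no term for the empty sum.
  ⨁⁺ : Summand → List Summand → Term 𝒮
  ⨁⁺ (α , s) []      = α • s
  ⨁⁺ (α , s) (q ∷ L) = (α • s) ⊕ ⨁⁺ q L

  amps : ∀ (p : Summand) L → Fin (suc (List.length L)) → Amp 𝒮
  amps p L i = proj₁ (List.lookup (p ∷ L) i)

  terms : ∀ (p : Summand) L → Fin (suc (List.length L)) → Term 𝒮
  terms p L i = proj₂ (List.lookup (p ∷ L) i)

  ⨁⁺-⨁ : ∀ p L → ⨁⁺ p L ≡ ⨁ (amps p L) (terms p L)
  ⨁⁺-⨁ p []      = refl
  ⨁⁺-⨁ p (q ∷ L) = cong (_ ⊕_) (⨁⁺-⨁ q L)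

  DistinctFrom : Term 𝒮 → Summand → Set
  DistinctFrom s q = s ≢ proj₂ q

  Distinct : List Summand → Set
  Distinct = AllPairs (λ p → DistinctFrom (proj₂ p))

  GroundSummand : (Term 𝒮 → Set) → Summand → Set
  GroundSummand P (α , s) = GroundAmp α × P s

  -- For classical `P` this differs from a canonical form in that amplitudes may be null: nullity is
  -- not decided at this stage.
  record Collected (P : Term 𝒮 → Set) (t : Term 𝒮) : Set where
    field
      {first}  : Summand
      {rest}   : List Summand
      ≋-sum    : t ≋ ⨁⁺ first rest
      distinct : Distinct (first ∷ rest)
      ground   : Allᴸ (GroundSummand P) (first ∷ rest)

  infix 4 _≟ₜ_by_

  _≟ₜ_by_ : ∀ s u → Classical s → Dec (s ≡ u)
  s ≟ₜ u by c with Coefficients.coeff-classical (ℂ-scalars 𝒮) c u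
  ... | inj₁ (eq , _)  = yes eq
  ... | inj₂ (neq , _) = no neq

  ⊕-leftComm : ∀ (r s t : Term 𝒮) → r ⊕ (s ⊕ t) ≋ s ⊕ (r ⊕ t)
  ⊕-leftComm r s t = ≋-trans (⊕-assoc r s t) (≋-trans (⊕-congˡ t (⊕-comm r s)) (≋-sym (⊕-assoc s r t)))

  module _ {P : Term 𝒮 → Set} (P-classical : ∀ {s} → P s → Classical s) where

    -- The last component is what keeps the terms distinct.
    insert : ∀ {α s} → GroundAmp α → P s → ∀ p L → Distinct (p ∷ L) → Allᴸ (GroundSummand P) (p ∷ L) →
             ∃ λ p′ → ∃ λ L′ → ((α • s) ⊕ ⨁⁺ p L ≋ ⨁⁺ p′ L′) × Distinct (p′ ∷ L′) ×
             Allᴸ (GroundSummand P) (p′ ∷ L′) ×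
             (∀ {r} → r ≢ s → Allᴸ (DistinctFrom r) (p ∷ L) → Allᴸ (DistinctFrom r) (p′ ∷ L′))
    insert {α} {s} gα ps (β , r) L ds gs with s ≟ₜ r by P-classical ps
    insert {α} {s} gα ps (β , s) []      (d ∷ ds) ((gβ , _) ∷ gs) | yes refl =
      (α +ᵃ β , s) , [] , •-merge α β s , d ∷ ds , (cong₂ _++_ gα gβ , ps) ∷ gs , λ { _ (n ∷ ns) → n ∷ ns }
    insert {α} {s} gα ps (β , s) (q ∷ L) (d ∷ ds) ((gβ , _) ∷ gs) | yes refl =
      (α +ᵃ β , s) , q ∷ L , ≋-trans (⊕-assoc _ _ _) (⊕-congˡ _ (•-merge α β s)) , d ∷ ds ,
      (cong₂ _++_ gα gβ , ps) ∷ gs , λ { _ (n ∷ ns) → n ∷ ns }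
    insert {α} {s} gα ps (β , r) []      ds g | no s≢r =
      (β , r) , (α , s) ∷ [] , ⊕-comm _ _ , ((s≢r ∘ sym) ∷ []) ∷ [] ∷ [] ,
      ListAll.head g ∷ (gα , ps) ∷ [] , λ { t≢s (n ∷ []) → n ∷ t≢s ∷ [] }
    insert {α} {s} gα ps (β , r) (q ∷ L) (d ∷ ds) (g ∷ gs) | no s≢r with insert gα ps q L ds gs
    ... | q′ , L′ , e , ds′ , gs′ , fresh =
      (β , r) , q′ ∷ L′ , ≋-trans (⊕-leftComm _ _ _) (⊕-congʳ _ e) , fresh (s≢r ∘ sym) d ∷ ds′ ,
      g ∷ gs′ , λ { t≢s (n ∷ ns) → n ∷ fresh t≢s ns }

    collect-onto : ∀ {u t} → LinComb P u → Collected P t → Collected P (u ⊕ t)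
    collect-onto (atom gα ps) c with insert gα ps _ _ (Collected.distinct c) (Collected.ground c)
    ... | _ , _ , e , ds , gs , _ = record
      { ≋-sum = ≋-trans (⊕-congʳ _ (Collected.≋-sum c)) e ; distinct = ds ; ground = gs }
    collect-onto {t = t} (_⊕_ {s} {s′} l l′) c = record
      { ≋-sum = ≋-trans (≋-sym (⊕-assoc s s′ t)) ≋-sum ; distinct = distinct ; ground = ground }
      where open Collected (collect-onto l (collect-onto l′ c))

    collect : ∀ {u} → LinComb P u → Collected P u
    collect (atom gα ps) = record { ≋-sum = ≋-refl ; distinct = [] ∷ [] ; ground = (gα , ps) ∷ [] }
    collect (l ⊕ l′)     = collect-onto l (collect l′)

  -- Null summands

  Null : Summand → Set
  Null (α , _) = ⟦ α ⟧≐ 0ℂ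

  null-stable : ∀ (α : Amp 𝒮) → ¬ ¬ (⟦ α ⟧≐ 0ℂ) → ⟦ α ⟧≐ 0ℂ
  null-stable α ¬¬α≐0 σ σ-val = ≈ℂ-stable (λ ≉0 → ¬¬α≐0 (λ α≐0 → ≉0 (α≐0 σ σ-val)))

  -- Each of α • s and α • t absorbs the other.
  null-• : ∀ {α : Amp 𝒮} → ⟦ α ⟧≐ 0ℂ → ∀ s t → α • s ≋ α • t
  null-• {α} α≐0 s t =
    ≋-trans (≋-sym (⊕-null (α • s) α t α≐0)) (≋-trans (⊕-comm (α • s) (α • t)) (⊕-null (α • t) α s α≐0))

  -- Applied to a collected sum, this is its canonical form; `covers` serves to find a given
  -- non-null summand again in it.
  record NonNullPart (p : Summand) (L : List Summand) : Set where
    field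
      {first}  : Summand
      {rest}   : List Summand
      ≋-sum    : ⨁⁺ p L ≋ ⨁⁺ first rest
      nonNull  : Allᴸ (¬_ ∘ Null) (first ∷ rest)
      sublist  : first ∷ rest ⊆ p ∷ L
      distinct : Distinct (p ∷ L) → Distinct (first ∷ rest)
      covers   : Allᴸ (λ q → Null q ⊎ q ∈ first ∷ rest) (p ∷ L)

  -- `⊕-null` erases a null summand only beside another summand, so a sum all of whose summands are
  -- null is kept as a separate case.
  nonNullPart : ∀ p L → Allᴸ (Dec ∘ Null) (p ∷ L) → Allᴸ Null (p ∷ L) ⊎ NonNullPart p L
  nonNullPart p [] (yes null ∷ []) = inj₁ (null ∷ [])
  nonNullPart p [] (no ¬null ∷ []) = inj₂ record
    { ≋-sum = ≋-refl ; nonNull = ¬null ∷ [] ; sublist = refl ∷ [] ; distinct = λ ds → ds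
    ; covers = inj₂ (here refl) ∷ [] }
  nonNullPart p@(α , s) (q ∷ L) (d ∷ ds) with d | nonNullPart q L ds
  ... | yes null | inj₁ nulls = inj₁ (null ∷ nulls)
  ... | yes null | inj₂ part  = inj₂ record
    -- `⊕-null` erases on the right, hence the exchange of head and tail.
    { ≋-sum = ≋-trans (⊕-comm _ _) (≋-trans (⊕-null _ α s null) ≋-sum) ; nonNull = nonNull
    ; sublist = p ∷ʳ sublist ; distinct = λ { (_ ∷ ds) → distinct ds }
    ; covers = inj₁ null ∷ covers }
    where open NonNullPart part
  ... | no ¬null | inj₁ nulls = inj₂ record
    { ≋-sum = drop-null (α • s) q L nulls ; nonNull = ¬null ∷ []
    ; sublist = refl ∷ minimum (q ∷ L) ; distinct = λ _ → [] ∷ []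
    ; covers = inj₂ (here refl) ∷ ListAll.map inj₁ nulls }
    where
    drop-null : ∀ t q L → Allᴸ Null (q ∷ L) → t ⊕ ⨁⁺ q L ≋ t
    drop-null t (β , u) []      (null ∷ [])    = ⊕-null t β u null
    drop-null t (β , u) (r ∷ L) (null ∷ nulls) = ≋-trans (⊕-assoc t (β • u) _)
      (≋-trans (⊕-congˡ _ (⊕-null t β u null)) (drop-null t r L nulls))
  ... | no ¬null | inj₂ part  = inj₂ record
    { ≋-sum = ⊕-congʳ _ ≋-sum ; nonNull = ¬null ∷ nonNull
    ; sublist = refl ∷ sublist ; distinct = λ { (d ∷ ds) → All-resp-⊆ sublist d ∷ distinct ds }
    ; covers = inj₂ (here refl) ∷
        ListAll.map (λ { (inj₁ null) → inj₁ null ; (inj₂ q∈) → inj₂ (there q∈) }) covers }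
    where open NonNullPart part

  distinct-lookup : ∀ L → Distinct L → ∀ i j → i ≢ j → proj₂ (List.lookup L i) ≢ proj₂ (List.lookup L j)
  distinct-lookup (_ ∷ _) _        zero    zero    i≢j = contradiction refl i≢j
  distinct-lookup (_ ∷ L) (d ∷ _)  zero    (suc j) _   = ListAll.lookup d (∈-lookup j)
  distinct-lookup (_ ∷ L) (d ∷ _)  (suc i) zero    _   = ListAll.lookup d (∈-lookup i) ∘ sym
  distinct-lookup (_ ∷ L) (_ ∷ ds) (suc i) (suc j) i≢j = distinct-lookup L ds i j (i≢j ∘ cong suc)

  NullOrValue : Summand → Set
  NullOrValue q = GroundAmp (proj₁ q) × (Null q ⊎ Value (proj₂ q))

  summand-≋-value : ∀ {α s} → NullOrValue (α , s) → ∃ λ v → Value v × α • s ≋ v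
  summand-≋-value {α} {s} (gα , inj₁ null) =
    -- `()` serves whatever the type of `s`, since the value to be found carries no typing
    -- condition.
    α • app (inj₁ unit) [] , scale gα (con unit []) , null-• null s _
  summand-≋-value {α} {s} (gα , inj₂ val)  = α • s , scale gα val , ≋-refl

  sum-≋-value : ∀ p L → Allᴸ NullOrValue (p ∷ L) → ∃ λ v → Value v × ⨁⁺ p L ≋ v
  sum-≋-value p []      (val ∷ [])   = summand-≋-value val
  sum-≋-value p (q ∷ L) (val ∷ vals) with summand-≋-value val | sum-≋-value q L vals
  ... | v , v-val , e | w , w-val , e′ = v ⊕ w , plus v-val w-val , ⊕-cong e e′

-- Progress

-- Selects the argument to evaluate: an evaluation context requires values to the left of its hole.
leftmost : ∀ {n} {P Q : Fin n → Set} → (∀ i → P i ⊎ Q i) →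
           (∀ i → P i) ⊎ ∃ λ i → Q i × (∀ j → j < i → P j)
leftmost {zero}  d = inj₁ λ ()
leftmost {suc n} d with d zero
... | inj₂ q = inj₂ (zero , q , λ _ ())
... | inj₁ p with leftmost (d ∘ suc)
...   | inj₁ ps           = inj₁ λ { zero → p ; (suc i) → ps i }
...   | inj₂ (i , q , ps) = inj₂ (suc i , q , λ { zero _ → p ; (suc j) (ℕ.s≤s j<i) → ps j j<i })

module _ {𝒮 : Signature} (ℜ : STRS 𝒮) where
  open STRS ℜ

  ↦-ground : ∀ {s t} → _↦_ ℜ s t → Ground t
  ↦-ground (fire {r = r} K σ _ σ-val _ g) = plug-ground K g (subst-ground σ-val r)

  -- A (C)-step without its conditions on the whole term, so that a redex of an argument is one of
  -- the application; `progress` restores these conditions from the typing.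
  Redex : Term 𝒮 → Set
  Redex s = ∃ λ K → ∃ λ σ → ∃ λ l → ∃ λ r → Rule l r × ValueSubst σ × s ≡ plug K (l [ σ ])

  module _ (total : Total ℜ) where

    -- The redex of the leftmost argument that has one extends to the whole term. If all arguments
    -- are values, a constructor gives a value, and for a function symbol totality gives a rule
    -- matching at the root.
    value-or-redex : ∀ {s T} → s ∶ᶜ T → Value s ⊎ Redex s
    value-or-redex (app b {ts} tys) with leftmost (λ i → value-or-redex (tys i))
    ... | inj₂ (i , (K , σ , l , r , rule , σ-val , eq) , vals) =
      inj₂ (app b i ts vals K , σ , l , r , rule , σ-val ,
            cong (app b) (trans (sym (Vec.[]≔-lookup ts i)) (cong (ts [ i ]≔_) eq)))
    value-or-redex (app (inj₁ c) tys)      | inj₁ vals = inj₁ (con c (lookup⁻ vals))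
    value-or-redex (app (inj₂ f) {ts} tys) | inj₁ vals
      with total f ts (lookup⁻ vals , λ i → ∶ᶜ-typing ℜ (tys i))
    ... | σ , l , r , σ-val , rule , eq = inj₂ (◇ , σ , l , r , rule , σ-val , sym eq)

    progress : ∀ {s T} → s ∶ᶜ T → Value s ⊎ ∃ (_↦_ ℜ s)
    progress ty with value-or-redex ty
    ... | inj₁ val = inj₁ val
    ... | inj₂ (K , σ , l , r , rule , σ-val , refl) =
      inj₂ (_ , fire K σ rule σ-val (∶ᶜ-classical ty) (∶ᶜ-ground ty))

    -- Rule (Q) applies: by progress each term is a value, which stays, or makes a (C)-step, and the
    -- one in `q` does the latter.
    canonical-step : ∀ {T p L} → Distinct (p ∷ L) → Allᴸ (GroundSummand (_∶ᶜ T)) (p ∷ L) →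
                     Allᴸ (¬_ ∘ Null) (p ∷ L) → ∀ {q} → q ∈ p ∷ L → ¬ Value (proj₂ q) →
                     ∃ λ t → _⟶_ ℜ (⨁⁺ p L) t × Ground t
    canonical-step {T} {p} {L} ds gs ns {q} q∈ ¬val =
      ⨁ α t , subst (λ u → _⟶_ ℜ u (⨁ α t)) (sym (⨁⁺-⨁ p L))
        (Q α s t (⨁-ground α s gα gs′) can steps (k , kstep)) , ⨁-ground α t gα gt
      where
      α = amps p L
      s = terms p L
      gα : ∀ i → GroundAmp (α i)
      gα i = proj₁ (ListAll.lookup gs (∈-lookup i))
      ty : ∀ i → s i ∶ᶜ T
      ty i = proj₂ (ListAll.lookup gs (∈-lookup i))
      gs′ : ∀ i → Ground (s i)
      gs′ i = ∶ᶜ-ground (ty i)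
      can : Canonical α s
      can = record
        { classical = λ i → ∶ᶜ-classical (ty i)
        ; distinct  = distinct-lookup (p ∷ L) ds
        ; nonNull   = λ i → ListAll.lookup ns (∈-lookup i)
        }
      -- The chosen reduct is bundled with the facts about it, so that a single case distinction on
      -- `progress` yields them all.
      Advance : Term 𝒮 → Set
      Advance u = ∃ λ u′ → _⟶?_ ℜ u u′ × (¬ Value u → _⟶_ ℜ u u′) × (Ground u → Ground u′)
      target : ∀ {u} → Value u ⊎ ∃ (_↦_ ℜ u) → Advance u
      target (inj₁ val) = _ , stay (λ { (_ , st) → value-hasNoFun val (↦-hasFun st) }) ,
                          (λ ¬val → contradiction val ¬val) , λ g → g
      target (inj₂ (u′ , st)) = u′ , step (C st) , (λ _ → C st) , λ _ → ↦-ground st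
      result : ∀ i → Advance (s i)
      result i = target (progress (ty i))
      t : Fin (suc (List.length L)) → Term 𝒮
      t i = proj₁ (result i)
      steps : ∀ i → _⟶?_ ℜ (s i) (t i)
      steps i = proj₁ (proj₂ (result i))
      gt : ∀ i → Ground (t i)
      gt i = proj₂ (proj₂ (proj₂ (result i))) (gs′ i)
      k : Fin (suc (List.length L))
      k = Any.index q∈
      kstep : _⟶_ ℜ (s k) (t k)
      kstep = proj₁ (proj₂ (proj₂ (result k)))
        (subst (λ q → ¬ Value (proj₂ q)) (lookup-index q∈) ¬val)

    normal-value : ∀ {t T} → Ground t → ⊢_∶_ ℜ t T → ¬ ∃ (_⟶_ ℜ t) → ∃ λ v → Value v × t ≋ v
    normal-value g ty irr with closed-decomposable ℜ ty refl refl
    ... | inj₁ (s , sty , t≋s) with progress sty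
    ...   | inj₁ val      = s , val , t≋s
    ...   | inj₂ (u , st) = contradiction (u , E g (↦-ground st) t≋s (C st) ≋-refl) irr
    normal-value {t} {T} g ty irr | inj₂ (u , l , t≋u) =
      let v , val , sum≋v = sum-≋-value first rest (ListAll.tabulate nullOrValue)
      in  v , val , ≋-trans t≋sum sum≋v
      where
      open Collected (collect ∶ᶜ-classical l)
      t≋sum : t ≋ ⨁⁺ first rest
      t≋sum = ≋-trans t≋u ≋-sum

      -- If `q` were not null, it would survive in the non-null part, where `canonical-step` and
      -- rule (E) would reduce `t`. The goal is a negation, so nullity of the summands may be taken
      -- as decided.
      reducible⇒¬¬null : ∀ {q} → q ∈ first ∷ rest → ¬ Value (proj₂ q) → ¬ ¬ Null q
      reducible⇒¬¬null q∈ ¬val ¬null = ¬¬-Dec-all (first ∷ rest) λ decs → case nonNullPart first rest decs of λ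
        { (inj₁ nulls) → ¬null (ListAll.lookup nulls q∈)
        ; (inj₂ part)  → case ListAll.lookup (NonNullPart.covers part) q∈ of λ
          { (inj₁ null) → ¬null null
          ; (inj₂ q∈′)  →
              let open NonNullPart part using (sublist; nonNull) renaming (distinct to distinct′; ≋-sum to ≋-sum′)
                  t′ , st , gt′ = canonical-step (distinct′ distinct) (All-resp-⊆ sublist ground) nonNull q∈′ ¬val
              in  irr (t′ , E g gt′ (≋-trans t≋sum ≋-sum′) st ≋-refl) } }

      nullOrValue : ∀ {q} → q ∈ first ∷ rest → NullOrValue q
      nullOrValue {q} q∈ with ListAll.lookup ground q∈
      ... | gα , sty with progress sty
      ...   | inj₁ val      = gα , inj₂ val
      ...   | inj₂ (_ , st) = gα , inj₁ (null-stable (proj₁ q)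
        (reducible⇒¬¬null q∈ (λ val → value-hasNoFun val (↦-hasFun st))))

lemma14 : (𝒮 : Signature) (ℜ : STRS 𝒮) → IsQTRS ℜ → Total ℜ →
    (t : Term 𝒮) → Ground t → WellTyped ℜ t →
    NF ℜ t ⇔ (∃ λ v → Value v × t ≋ v)
lemma14 𝒮 ℜ _ total t g (T , ty) = mk⇔
  (λ (_ , irr) → normal-value ℜ total g ty irr)
  (λ (v , val , t≋v) → g , Coefficients.value-irreducible (ℂ-scalars 𝒮) ℜ 1ℂ≉0ℂ (ℂ-eval-ground 𝒮) val t≋v)
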